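{- Let $G$ be an infinite group and $A\subseteq G$. Then: (i) for $n\in\mathbb{N}$, $A$ is not $n$-thin if and only if there exist a subset $F\subseteq G$ with $|F|=n+1$ and an injective sequence $(x_k)_{k<\omega}$ in $G$ such that $Fx_k\subseteq A$ for every $k\in\omega$; (ii) $A$ is not sparse if and only if there exist injective sequences $(x_n)_{n<\omega}$, $(y_n)_{n<\omega}$ in $G$ with $x_ny_m\in A$ for all $0\le n\le m<\omega$; (iii) $A$ is not scattered if and only if $A$ contains a piecewise shifted $FP$-set; (iv) $A$ contains a recurrent subset if and only if there exist $x\in A$ and an $FP$-set $Y$ with $xY\subseteq A$.
   Context: $A$ is $n$-thin if for all distinct $g_0,\dots,g_n\in G$ the set $g_0A\cap\dots\cap g_nA$ is finite. $A$ is sparse if for every infinite $X\subseteq G$ there is finite $F\subseteq X$ with $\bigcap_{g\in F}gA$ finite. Identify $\beta G$ with the ultrafilters on $G$ ($gp=\{gP:P\in p\}$), $G^*$ the free ultrafilters, $X^*=\{p\in G^*:X\in p\}$, $\Delta_p(X)=\{gp:g\in G, X\in gp\}$; $A$ is scattered if for every infinite $X\subseteq A$ there is $p\in X^*$ with $\Delta_p(X)$ finite. For an injective sequence $(g_n)_{n\in\omega}$ in $G$, the set $\{g_{i_1}g_{i_2}\cdots g_{i_k}: k\ge1, 0\le i_1<\dots<i_k<\omega\}$ is an $FP$-set; given additionally any sequence $(b_n)_{n\in\omega}$ in $G$, the set $\{g_{i_1}\cdots g_{i_k}b_{i_k}: k\ge1, 0\le i_1<\dots<i_k<\omega\}$ is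 a piecewise shifted $FP$-set. Identify $\mathcal{P}_G$ with $\{0,1\}^G$ (product topology) as a $G$-space via $(B,g)\mapsto Bg$; $B\subseteq G$ is recurrent if for every neighbourhood $U$ of $B$ in $\mathcal{P}_G$ the set $\{g\in G: Bg\in U\}$ is infinite.
   Formalization: In (iv) the recurrent subset is required to be nonempty: the empty set is recurrent under the stated definition, so (iv) as written fails, for example, for A = ∅. -}

module Defs where

open import Level using (Level; _⊔_; Lift; lift) renaming (suc to lsuc)
open import Algebra.Bundles using (Group)
import Algebra.Properties.Group as GroupProperties
open import Data.Empty.Polymorphic using (⊥)
open import Data.Fin.Base using (Fin)
open import Data.List.Base using (List; foldr; _∷ʳ_)
open import Data.List.Relation.Unary.All using (All)
open import Data.List.Relation.Unary.Linked using (Linked)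
open import Data.Nat.Base using (ℕ; _<_) renaming (suc to 1+_)
open import Data.Product.Base using (Σ; ∃-syntax; _×_; _,_)
open import Data.Sum.Base using (_⊎_; inj₁; inj₂)
open import Data.Unit.Polymorphic using (⊤; tt)
open import Function.Base using (id; _∘_)
open import Function.Bundles using (_⇔_; mk⇔; Equivalence)
open import Function.Definitions using (Injective)
open import Relation.Binary.Bundles using (Setoid)
open import Relation.Binary.Definitions using (_Respects_)
open import Relation.Binary.PropositionalEquality.Core using (_≡_)
open import Relation.Nullary.Negation.Core using (¬_)
open import Relation.Unary using (Pred)

module Cardinality {a b} (S : Setoid a b) where
  open Setoid S

  infix 4 _HasSize_

  _HasSize_ : ∀ {p} → Pred Carrier p → ℕ → Set (a ⊔ b ⊔ p)
  P HasSize n = Σ (Fin n → Carrier) λ e →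
    Injective _≡_ _≈_ e × (∀ x → P x ⇔ (∃[ i ] x ≈ e i))

  Finite : ∀ {p} → Pred Carrier p → Set (a ⊔ b ⊔ p)
  Finite P = ∃[ n ] P HasSize n

  Infinite : ∀ {p} → Pred Carrier p → Set (a ⊔ b ⊔ p)
  Infinite P = ¬ Finite P

module SubsetsOf {c ℓ} (G : Group c ℓ) where
  open Group G
  open GroupProperties G using (∙-cancelˡ)
  open Cardinality setoid public

  s : Level
  s = c ⊔ ℓ

  InfiniteGroup : Set s
  InfiniteGroup = Infinite {c} (λ _ → ⊤)

  InjectiveSeq : (ℕ → Carrier) → Set ℓ
  InjectiveSeq = Injective _≡_ _≈_

  -- Elements of G are Carrier up to _≈_, so a subset must respect _≈_.
  record Subset : Set (lsuc s) where
    field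
      pred     : Pred Carrier s
      respects : pred Respects _≈_

  open Subset

  infix 4 _∈_ _⊆_ _≐_
  infixr 6 _∩_
  infixr 7 _⊲_
  infixl 7 _⊳_

  _∈_ : Carrier → Subset → Set s
  x ∈ A = pred A x

  _⊆_ : Subset → Subset → Set s
  A ⊆ B = ∀ x → x ∈ A → x ∈ B

  _≐_ : Subset → Subset → Set s
  A ≐ B = ∀ x → x ∈ A ⇔ x ∈ B

  subsetSetoid : Setoid (lsuc s) s
  subsetSetoid = record
    { Carrier = Subset
    ; _≈_ = _≐_
    ; isEquivalence = record
      { refl  = λ x → mk⇔ id id
      ; sym   = λ e x → mk⇔ (from (e x)) (to (e x))
      ; trans = λ e f x → mk⇔ (to (f x) ∘ to (e x)) (from (e x) ∘ from (f x))
      }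
    }
    where open Equivalence

  ∅ : Subset
  ∅ = record { pred = λ _ → ⊥ ; respects = λ _ → id }

  full : Subset
  full = record { pred = λ _ → ⊤ ; respects = λ _ → id }

  _∩_ : Subset → Subset → Subset
  A ∩ B = record
    { pred = λ x → x ∈ A × x ∈ B
    ; respects = λ e (xA , xB) → respects A e xA , respects B e xB
    }

  ∁ : Subset → Subset
  ∁ A = record { pred = λ x → ¬ x ∈ A ; respects = λ e x∉A → x∉A ∘ respects A (sym e) }

  -- g ⊲ A is gA and A ⊳ g is Ag.
  _⊲_ : Carrier → Subset → Subset
  g ⊲ A = record
    { pred = λ x → ∃[ a ] a ∈ A × x ≈ g ∙ a
    ; respects = λ e (a , aA , x≈) → a , aA , trans (sym e) x≈
    }

  _⊳_ : Subset → Carrier → Subset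
  A ⊳ g = record
    { pred = λ x → ∃[ a ] a ∈ A × x ≈ a ∙ g
    ; respects = λ e (a , aA , x≈) → a , aA , trans (sym e) x≈
    }

  Thin : ℕ → Subset → Set s
  Thin n A = (g : Fin (1+ n) → Carrier) → Injective _≡_ _≈_ g →
    Finite (λ x → ∀ i → x ∈ g i ⊲ A)

  Sparse : Subset → Set (lsuc s)
  Sparse A = ∀ X → Infinite (_∈ X) →
    ∃[ F ] F ⊆ X × Finite (_∈ F) × Finite (λ x → ∀ g → g ∈ F → x ∈ g ⊲ A)

  record Ultrafilter : Set (lsuc (lsuc s)) where
    field
      member  : Pred Subset (lsuc s)
      proper  : ¬ member ∅
      univ    : member full
      meet    : ∀ {X Y} → member X → member Y → member (X ∩ Y)
      upward  : ∀ {X Y} → X ⊆ Y → member X → member Y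
      ultra   : ∀ X → member X ⊎ member (∁ X)

  open Ultrafilter

  infix 4 _∈ᵤ_ _≈ᵤ_
  infixr 7 _⊲ᵤ_

  _∈ᵤ_ : Subset → Ultrafilter → Set (lsuc s)
  X ∈ᵤ p = member p X

  _≈ᵤ_ : Ultrafilter → Ultrafilter → Set (lsuc s)
  p ≈ᵤ q = ∀ X → X ∈ᵤ p ⇔ X ∈ᵤ q

  ultrafilterSetoid : Setoid (lsuc (lsuc s)) (lsuc s)
  ultrafilterSetoid = record
    { Carrier = Ultrafilter
    ; _≈_ = _≈ᵤ_
    ; isEquivalence = record
      { refl  = λ X → mk⇔ id id
      ; sym   = λ e X → mk⇔ (from (e X)) (to (e X))
      ; trans = λ e f X → mk⇔ (to (f X) ∘ to (e X)) (from (e X) ∘ from (f X))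
      }
    }
    where open Equivalence

  private
    shift : ∀ g x → x ≈ g ∙ (g ⁻¹ ∙ x)
    shift g x = sym (trans (sym (assoc _ _ _)) (trans (∙-congʳ (inverseʳ g)) (identityˡ x)))

    unshift : ∀ g x → x ≈ g ⁻¹ ∙ (g ∙ x)
    unshift g x = sym (trans (sym (assoc _ _ _)) (trans (∙-congʳ (inverseˡ g)) (identityˡ x)))

    ⊲-intro : ∀ {g x} P → g ⁻¹ ∙ x ∈ P → x ∈ g ⊲ P
    ⊲-intro {g} {x} P h = g ⁻¹ ∙ x , h , shift g x

    ⊲-elim : ∀ {g x} P → g ∙ x ∈ g ⊲ P → x ∈ P
    ⊲-elim {g} {x} P (a , aP , e) = respects P (sym (∙-cancelˡ g x a e)) aP

    ⊲-∘ : ∀ g X → X ≐ g ⊲ g ⁻¹ ⊲ X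
    ⊲-∘ g X x = mk⇔
      (λ xX → g ⁻¹ ∙ x , (x , xX , refl) , shift g x)
      λ (a , (b , bX , a≈) , x≈) →
        respects X (sym (trans x≈ (trans (∙-congˡ a≈) (sym (shift g b))))) bX

  -- gp = { gP : P ∈ p }
  _⊲ᵤ_ : Carrier → Ultrafilter → Ultrafilter
  g ⊲ᵤ p = record
    { member = λ X → ∃[ P ] P ∈ᵤ p × X ≐ g ⊲ P
    ; proper = λ (P , P∈p , e) → proper p (upward p
        (λ x xP → from (e (g ∙ x)) (x , xP , refl)) P∈p)
    ; univ = full , univ p , λ x → mk⇔ (λ _ → ⊲-intro full tt) _
    ; meet = λ (P , P∈p , e) (Q , Q∈p , f) → P ∩ Q , meet p P∈p Q∈p , λ x → mk⇔
        (λ (xX , xY) →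
          let move = λ R → respects (g ⊲ R) (shift g x)
          in ⊲-intro (P ∩ Q) ( ⊲-elim P (move P (to (e x) xX))
                             , ⊲-elim Q (move Q (to (f x) xY))))
        (λ (a , (aP , aQ) , x≈) → from (e x) (a , aP , x≈) , from (f x) (a , aQ , x≈))
    ; upward = λ {X} {Y} X⊆Y (P , P∈p , e) → g ⁻¹ ⊲ Y , upward p
        (λ x xP → g ∙ x , X⊆Y _ (from (e (g ∙ x)) (x , xP , refl)) , unshift g x) P∈p
        , ⊲-∘ g Y
    ; ultra = λ X → ultra′ X (ultra p (g ⁻¹ ⊲ X))
    }
    where
    open Equivalence
    Member : Subset → Set (lsuc s)
    Member X = ∃[ P ] P ∈ᵤ p × X ≐ g ⊲ P
    ultra′ : ∀ X → g ⁻¹ ⊲ X ∈ᵤ p ⊎ ∁ (g ⁻¹ ⊲ X) ∈ᵤ p → Member X ⊎ Member (∁ X)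
    ultra′ X (inj₁ h) = inj₁ (g ⁻¹ ⊲ X , h , ⊲-∘ g X)
    ultra′ X (inj₂ h) = inj₂ (∁ (g ⁻¹ ⊲ X) , h , λ x → mk⇔
      (λ x∉X → ⊲-intro (∁ (g ⁻¹ ⊲ X)) λ m → x∉X (from (⊲-∘ g X x) (⊲-intro (g ⁻¹ ⊲ X) m)))
      (λ (a , a∉ , x≈) xX → a∉ (x , xX , trans (unshift g a) (∙-congˡ (sym x≈)))))

  Free : Ultrafilter → Set (lsuc s)
  Free p = ∀ x → ¬ (∀ X → X ∈ᵤ p → x ∈ X)

  -- p ∈ X*
  _∈*_ : Ultrafilter → Subset → Set (lsuc s)
  p ∈* X = Free p × X ∈ᵤ p

  Δ : Ultrafilter → Subset → Pred Ultrafilter (lsuc s)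
  Δ p X q = ∃[ g ] X ∈ᵤ g ⊲ᵤ p × q ≈ᵤ g ⊲ᵤ p

  Scattered : Subset → Set (lsuc (lsuc s))
  Scattered A = ∀ X → Infinite (_∈ X) → X ⊆ A →
    ∃[ p ] p ∈* X × Cardinality.Finite ultrafilterSetoid (Δ p X)

  prod : (ℕ → Carrier) → List ℕ → Carrier
  prod g = foldr (λ i x → g i ∙ x) ε

  -- The index sequence i₁ < ⋯ < iₖ (k ≥ 1) is the list is ∷ʳ j, so j = iₖ.
  FP : (ℕ → Carrier) → Subset
  FP g = record
    { pred = λ x → Σ (List ℕ) λ is → ∃[ j ]
        Linked _<_ (is ∷ʳ j) × Lift c (x ≈ prod g (is ∷ʳ j))
    ; respects = λ e (is , j , l , lift x≈) → is , j , l , lift (trans (sym e) x≈)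
    }

  PiecewiseShiftedFP : (ℕ → Carrier) → (ℕ → Carrier) → Subset
  PiecewiseShiftedFP g b = record
    { pred = λ x → Σ (List ℕ) λ is → ∃[ j ]
        Linked _<_ (is ∷ʳ j) × Lift c (x ≈ prod g (is ∷ʳ j) ∙ b j)
    ; respects = λ e (is , j , l , lift x≈) → is , j , l , lift (trans (sym e) x≈)
    }

  IsFPSet : Subset → Set s
  IsFPSet Y = ∃[ g ] InjectiveSeq g × Y ≐ FP g

  IsPiecewiseShiftedFPSet : Subset → Set s
  IsPiecewiseShiftedFPSet Y = ∃[ g ] ∃[ b ] InjectiveSeq g × Y ≐ PiecewiseShiftedFP g b

  -- Product topology on {0,1}^G: a basic neighbourhood of B fixes the
  -- coordinates of B at finitely many elements of G.
  Open : Pred Subset s → Set (lsuc s)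
  Open V = ∀ B → V B → Σ (List Carrier) λ xs →
    ∀ B′ → All (λ x → x ∈ B ⇔ x ∈ B′) xs → V B′

  Neighbourhood : Subset → Pred Subset s → Set (lsuc s)
  Neighbourhood B U = U Respects _≐_ ×
    Σ (Pred Subset s) λ V → Open V × V B × (∀ B′ → V B′ → U B′)

  Recurrent : Subset → Set (lsuc s)
  Recurrent B = ∀ U → Neighbourhood B U → Infinite (λ g → U (B ⊳ g))

{-# OPTIONS --safe #-}
module Submission where

open import Defs
open import Algebra.Bundles using (Group)
import Algebra.Properties.Group as GroupProperties
open import Axiom.ExcludedMiddle using (ExcludedMiddle)
open import Axiom.Extensionality.Propositional using (Extensionality)
open import Data.Bool.Base using (Bool; true; false; T)
open import Data.Empty using (⊥; ⊥-elim)
open import Data.Fin.Base using (Fin; zero; suc; toℕ)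
open import Data.Fin.Properties using (pigeonhole; toℕ<n)
open import Data.List.Base using (List; []; _∷_; _++_; _∷ʳ_; cartesianProductWith; foldr; length; lookup; map; tabulate)
open import Data.List.Membership.Propositional using (lose) renaming (_∈_ to _∈ₗ_)
open import Data.List.Membership.Propositional.Properties using (∈-++⁺ˡ; ∈-++⁺ʳ; ∈-++⁻; ∈-cartesianProductWith⁺; ∈-cartesianProductWith⁻; ∈-map⁺; ∈-map⁻)
open import Data.List.Relation.Binary.Subset.Propositional using () renaming (_⊆_ to _⊆ₗ_)
open import Data.List.Relation.Unary.All as All using (All; []; _∷_)
import Data.List.Relation.Unary.All.Properties as All
open import Data.List.Relation.Unary.Any as Any using (Any; here; there; index)
import Data.List.Relation.Unary.Any.Properties as Any
open import Data.List.Relation.Unary.Linked using (Linked; []; [-]; _∷_)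
open import Data.Nat.Base using (ℕ; zero; suc; _+_; _≤_; _<_; z≤n; s≤s; s≤s⁻¹) renaming (_⊔_ to _⊔ₙ_)
open import Data.Nat.Properties using (+-cancelˡ-≡; <-cmp; <⇒≢; >⇒≢; _≤?_; m<1+n⇒m<n∨m≡n; m≤m+n; m≤n⇒m<n∨m≡n; m⊔n≤o⇒m≤o; m⊔n≤o⇒n≤o; n<1+n; n≤1+n; ≤-trans; ≰⇒>)
open import Data.Product.Base using (Σ; ∃-syntax; _×_; _,_; proj₁; proj₂)
open import Data.Sum.Base as Sum using (_⊎_; inj₁; inj₂; [_,_]′)
open import Data.Unit.Polymorphic.Base using (⊤; tt)
open import Function.Base using (id; _∘_)
open import Function.Bundles using (_⇔_; mk⇔; Equivalence)
open import Function.Definitions using (Injective)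
open import Level using (Level; Lift; lift; lower; _⊔_) renaming (suc to lsuc)
open import Relation.Binary.Bundles using (Setoid)
open import Relation.Binary.Definitions using (_Respects_; tri<; tri≈; tri>)
open import Relation.Binary.PropositionalEquality as ≡ using (_≡_)
import Relation.Binary.Reasoning.Setoid as SetoidReasoning
open import Relation.Nullary.Decidable using (Dec; yes; no; ⌊_⌋; decidable-stable; fromWitness; toWitness)
open import Relation.Nullary.Negation.Core using (¬_; contradiction)
open import Relation.Unary using (Pred)

-- Parts (i) and (ii) are diagonal constructions of injective sequences.
--
-- (iii) Let X ⊆ A be infinite with every Δ_p(X), p ∈ X*, infinite. Among the nonempty
-- closed sets C ⊆ X* such that q ∈ C and X ∈ gq imply gq ∈ C, take a minimal one and a
-- point p of it. If P ∈ p, then by minimality finitely many translates of P cover the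
-- points gp with X ∈ gp, so P ∈ gp for infinitely many g (else Δ_p(X) is finite). Hence
-- one can choose X₀ = X, Xₙ₊₁ = Xₙ ∩ gₙ⁻¹Xₙ ∈ p, bₙ ∈ Xₙ₊₁ with the gₙ distinct, and the
-- shifted products of (gₙ), (bₙ) lie in X. Conversely, if Y is the piecewise shifted
-- FP-set of (gₙ), (bₙ) and p ∈ Y*, then for each m some vp contains the part of Y using
-- indices ≥ m only, so g₀vp, …, gₘ₋₁vp ∈ Δ_p(Y), and these are distinct since G acts freely.
-- The minimal closed set, the ultrafilters and the freeness of the action all come from
-- Tukey's lemma on properties of finite character.
--
-- (iv) If B is recurrent and b ∈ B, then any finite bP ⊆ B with ε ∈ P satisfies bPg ⊆ B for
-- infinitely many g, which builds the FP-set. Conversely, pass to a subsequence (hₙ) with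
-- hₙ ∉ P⁻¹PP⁻¹P, P being the set of products of earlier terms; then B = x(FP(h) ∪ {ε}) is
-- recurrent along the hₙ⁻¹.

-- Consequences of excluded middle.

module Classical (em : ∀ a → ExcludedMiddle a) where

  by-contradiction : ∀ {a} {P : Set a} → ¬ ¬ P → P
  by-contradiction = decidable-stable (em _)

  ¬∀⇒∃¬ : ∀ {a b} {I : Set a} {P : I → Set b} → ¬ (∀ i → P i) → ∃[ i ] ¬ P i
  ¬∀⇒∃¬ h = by-contradiction λ n → h λ i → by-contradiction λ ¬p → n (i , ¬p)

  ¬→ : ∀ {a b} {P : Set a} {Q : Set b} → ¬ (P → Q) → P × ¬ Q
  ¬→ h = by-contradiction (λ ¬p → h λ p → ⊥-elim (¬p p)) , λ q → h λ _ → q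

-- Ordinals and Tukey's lemma.

-- Tree ordinals under simulation stand in for the von Neumann ordinals in the transfinite
-- construction of a maximal consistent set.
data Ord (a : Level) : Set (lsuc a) where
  sup : (I : Set a) → (I → Ord a) → Ord a

infix 4 _≼_ _≺_

_≼_ : ∀ {a} → Ord a → Ord a → Set a
sup I f ≼ sup J g = ∀ i → ∃[ j ] f i ≼ g j

_≺_ : ∀ {a} → Ord a → Ord a → Set a
α ≺ sup J g = ∃[ j ] α ≼ g j

≼-refl : ∀ {a} (α : Ord a) → α ≼ α
≼-refl (sup I f) i = i , ≼-refl (f i)

module _ (em : ∀ a → ExcludedMiddle a) where
  open Classical em

  -- By induction: if `f i` lies below no `g j`, then every `g j` lies strictly below `f i`, so
  -- `sup J g ≼ f i`.
  ≼-or-≻ : ∀ {a} (α β : Ord a) → α ≼ β ⊎ β ≺ α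
  ≼-or-≻ (sup I f) (sup J g) with em _ {∀ i → ∃[ j ] f i ≼ g j}
  ... | yes p = inj₁ p
  ... | no ¬p with ¬∀⇒∃¬ ¬p
  ... | i , ¬q = inj₂ (i , below (f i) (λ j → [ (λ p → ⊥-elim (¬q (j , p))) , id ]′ (≼-or-≻ (f i) (g j))))
    where
    below : ∀ γ → (∀ j → g j ≺ γ) → sup J g ≼ γ
    below (sup K h) p = p

-- Sets are Bool-valued so that, by extensionality, stages with the same elements are equal
-- and hence have the same choice of next element.
module Tukey
  (em : ∀ a → ExcludedMiddle a) (fe : ∀ a b → Extensionality a b)
  {a b : Level} {A : Set a} (Bad : List A → Set b)
  (Bad-mono : ∀ {l l′} → l ⊆ₗ l′ → Bad l → Bad l′)
  (base : A → Bool)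
  where
  open Classical em

  Within : List A → (A → Bool) → Set a
  Within l S = ∀ {x} → x ∈ₗ l → T (S x)

  Consistent : (A → Bool) → Set (a ⊔ b)
  Consistent S = ∀ l → Within l S → ¬ Bad l

  private
    ⟦_⟧ : ∀ {p} → Set p → Bool
    ⟦ P ⟧ = ⌊ em _ {P} ⌋

    ⟦⟧⁺ : ∀ {p} {P : Set p} → P → T ⟦ P ⟧
    ⟦⟧⁺ = fromWitness

    ⟦⟧⁻ : ∀ {p} {P : Set p} → T ⟦ P ⟧ → P
    ⟦⟧⁻ = toWitness

    T-antisym : ∀ {x y} → (T x → T y) → (T y → T x) → x ≡ y
    T-antisym {false} {false} _ _ = ≡.refl
    T-antisym {false} {true}  _ g = ⊥-elim (g _)
    T-antisym {true}  {false} f _ = ⊥-elim (f _)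
    T-antisym {true}  {true}  _ _ = ≡.refl

    add : (A → Bool) → A → A → Bool
    add S x y = ⟦ T (S y) ⊎ y ≡ x ⟧

    Extendable : (A → Bool) → Set (a ⊔ b)
    Extendable S = ∃[ x ] ¬ T (S x) × Consistent (add S x)

    grow : ∀ S → Dec (Extendable S) → A → Bool
    grow S (yes (x , _)) = add S x
    grow S (no _)        = S

    next : (A → Bool) → A → Bool
    next S = grow S (em _)

    next-incr : ∀ S x → T (S x) → T (next S x)
    next-incr S x t with em _ {Extendable S}
    ... | yes _ = ⟦⟧⁺ (inj₁ t)
    ... | no _  = t

    next-consistent : ∀ S → Consistent S → Consistent (next S)
    next-consistent S c with em _ {Extendable S}
    ... | yes (_ , _ , c′) = c′
    ... | no _             = c

    next-new : ∀ S → Extendable S → ∃[ x ] ¬ T (S x) × T (next S x)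
    next-new S e with em _ {Extendable S}
    ... | yes (x , x∉ , _) = x , x∉ , ⟦⟧⁺ (inj₂ ≡.refl)
    ... | no ¬e            = contradiction e ¬e

    stage : Ord a → A → Bool
    stage (sup I f) x = ⟦ T (base x) ⊎ ∃[ i ] T (next (stage (f i)) x) ⟧

    -- next is not monotone in itself, so comparable stages are compared
    -- either as equal sets or through a later step.
    stage-mono : ∀ α β → α ≼ β → ∀ x → T (stage α x) → T (stage β x)
    stage-≺ : ∀ α β → α ≺ β → ∀ x → T (next (stage α) x) → T (stage β x)
    next-mono : ∀ α β → α ≼ β → ∀ x → T (next (stage α) x) → T (next (stage β) x)

    stage-mono (sup I f) (sup J g) p x t with ⟦⟧⁻ t
    ... | inj₁ b       = ⟦⟧⁺ (inj₁ b)
    ... | inj₂ (i , u) = let j , q = p i in ⟦⟧⁺ (inj₂ (j , next-mono (f i) (g j) q x u))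

    stage-≺ α (sup J g) (j , q) x t = ⟦⟧⁺ (inj₂ (j , next-mono α (g j) q x t))

    next-mono α β p x t with ≼-or-≻ em β α
    ... | inj₁ q = ≡.subst (λ S → T (next S x))
                     (fe _ _ λ y → T-antisym (stage-mono α β p y) (stage-mono β α q y)) t
    ... | inj₂ q = next-incr (stage β) x (stage-≺ α β q x t)

    base⊆stage : ∀ α x → T (base x) → T (stage α x)
    base⊆stage (sup _ _) x b = ⟦⟧⁺ (inj₁ b)

    extend : ∀ {S x l} → T (S x) → Within l S → Within (x ∷ l) S
    extend t w (here ≡.refl) = t
    extend t w (there m)     = w m

    -- Earlier stages form a chain, so a finite list settles in a single one. The `base` alternative
    -- is what remains when `I` is empty.
    within-stage : ∀ {I} (f : I → Ord a) l → Within l (stage (sup I f)) →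
      Within l base ⊎ ∃[ i ] Within l (next (stage (f i)))
    within-stage f [] w = inj₁ λ ()
    within-stage f (x ∷ l) w with ⟦⟧⁻ (w (here ≡.refl)) | within-stage f l (w ∘ there)
    ... | inj₁ b       | inj₁ h       = inj₁ (extend b h)
    ... | inj₁ b       | inj₂ (i , h) =
      inj₂ (i , extend (next-incr (stage (f i)) x (base⊆stage (f i) x b)) h)
    ... | inj₂ (i , t) | inj₁ h       =
      inj₂ (i , extend t (λ m → next-incr (stage (f i)) _ (base⊆stage (f i) _ (h m))))
    ... | inj₂ (i , t) | inj₂ (j , h) with ≼-or-≻ em (f i) (f j)
    ...   | inj₁ p = inj₂ (j , extend (next-mono (f i) (f j) p x t) h)
    ...   | inj₂ p =
      inj₂ (i , extend t (λ m → next-incr (stage (f i)) _ (stage-≺ (f j) (f i) p _ (h m))))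

    stage-consistent : Consistent base → ∀ α → Consistent (stage α)
    stage-consistent c (sup I f) l w bad with within-stage f l w
    ... | inj₁ h       = c l h bad
    ... | inj₂ (i , h) = next-consistent (stage (f i)) (stage-consistent c (f i)) l h bad

    -- If every stage were extendable, then the stages would inject the
    -- ordinals into A, and the supremum over that image is a stage above itself.
    some-stage-maximal : ∃[ α ] ¬ Extendable (stage α)
    some-stage-maximal = by-contradiction λ none →
      let new : ∀ α → ∃[ x ] ¬ T (stage α x) × T (next (stage α) x)
          new α = next-new (stage α) (by-contradiction λ ¬e → none (α , ¬e))
          Hit : Pred A (lsuc a)
          Hit t = ∃[ α ] proj₁ (new α) ≡ t
          I = Σ A λ t → T ⟦ Hit t ⟧
          at : I → Ord a
          at i = proj₁ (⟦⟧⁻ (proj₂ i))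
          β = sup I at
          i : I
          i = proj₁ (new β) , ⟦⟧⁺ (β , ≡.refl)
          same : proj₁ (new (at i)) ≡ proj₁ (new β)
          same = proj₂ (⟦⟧⁻ (proj₂ i))
      in proj₁ (proj₂ (new β))
           (≡.subst (T ∘ stage β) same
             (stage-≺ (at i) β (i , ≼-refl (at i)) _ (proj₂ (proj₂ (new (at i))))))

    -- Moves `x` to the head, so that `Bad-mono` turns a bad list of the enlarged set into a bad
    -- `x ∷ l′` with `l′` inside `S`.
    split-add : ∀ {S x} l → Within l (add S x) → ∃[ l′ ] Within l′ S × l ⊆ₗ x ∷ l′
    split-add [] w = [] , (λ ()) , λ ()
    split-add {S} {x} (y ∷ l) w
      with ⟦⟧⁻ (w (here ≡.refl)) | split-add l (w ∘ there)
    ... | inj₁ t      | l′ , w′ , sub = y ∷ l′ , extend t w′ , λ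
      { (here ≡.refl) → there (here ≡.refl)
      ; (there m)     → skip (sub m)
      }
      where
      skip : ∀ {z} → z ∈ₗ x ∷ l′ → z ∈ₗ x ∷ y ∷ l′
      skip (here p)  = here p
      skip (there m) = there (there m)
    ... | inj₂ ≡.refl | l′ , w′ , sub = l′ , w′ , λ { (here ≡.refl) → here ≡.refl ; (there m) → sub m }

  abstract
    -- Tukey's lemma with maximality in working form: since the chosen stage cannot be extended,
    -- each outside point is bad together with finitely many members.
    maximal : Consistent base → ∃[ M ] (∀ x → T (base x) → T (M x)) × Consistent M ×
      (∀ x → ¬ T (M x) → ∃[ l ] Within l M × Bad (x ∷ l))
    maximal c = let α , ¬e = some-stage-maximal in
      stage α , base⊆stage α , stage-consistent c α , λ x x∉ →
        let l , h   = ¬∀⇒∃¬ λ c′ → ¬e (x , x∉ , c′)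
            w , ¬¬b = ¬→ h
            l′ , w′ , sub = split-add l w
        in l′ , w′ , Bad-mono sub (by-contradiction ¬¬b)

-- Sequences built by dependent choice.

prefix : ∀ {a} {A : Set a} → (ℕ → A) → ℕ → List A
prefix x zero    = []
prefix x (suc n) = x n ∷ prefix x n

length-prefix : ∀ {a} {A : Set a} (x : ℕ → A) n → length (prefix x n) ≡ n
length-prefix x zero    = ≡.refl
length-prefix x (suc n) = ≡.cong suc (length-prefix x n)

prefix⁺ : ∀ {a q} {A : Set a} {Q : Pred A q} x {m n} → m < n → Q (x m) → Any Q (prefix x n)
prefix⁺ x {m} {suc n} m<1+n q with m<1+n⇒m<n∨m≡n m<1+n
... | inj₁ m<n    = there (prefix⁺ x m<n q)
... | inj₂ ≡.refl = here q

module _ {a p} {A : Set a} (Q : List A → Pred A p) where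

  Along : List A → Set p
  Along []      = ⊤
  Along (y ∷ l) = Q l y × Along l

  abstract
    -- The recursion carries the list so far with its `Along` proof, because `step` applies only to
    -- lists built this way.
    dependent-choice : (∀ l → Along l → ∃[ y ] Q l y) →
      ∃[ x ] (∀ n → Q (prefix x n) (x n))
    dependent-choice step = x , λ n →
        ≡.subst (λ l → Q l (x n)) (prefix-state n) (proj₂ (choice n))
      where
      state : ℕ → Σ (List A) Along
      state zero    = [] , tt
      state (suc n) = let l , h = state n ; y , q = step l h in y ∷ l , q , h
      choice : ∀ n → ∃[ y ] Q (proj₁ (state n)) y
      choice n = let l , h = state n in step l h
      x : ℕ → A
      x n = proj₁ (choice n)
      prefix-state : ∀ n → proj₁ (state n) ≡ prefix x n
      prefix-state zero    = ≡.refl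
      prefix-state (suc n) = ≡.cong (x n ∷_) (prefix-state n)

  along-prefix : ∀ {x} → (∀ n → Q (prefix x n) (x n)) → ∀ n → Along (prefix x n)
  along-prefix h zero    = tt
  along-prefix h (suc n) = h n , along-prefix h n

eventually-all : ∀ {a r} {A : Set a} {R : A → ℕ → Set r} {l} →
  All (λ y → ∃[ N ] ∀ m → N ≤ m → R y m) l →
  ∃[ N ] ∀ m → N ≤ m → All (λ y → R y m) l
eventually-all []             = 0 , λ _ _ → []
eventually-all ((M , h) ∷ hs) = let N , hs′ = eventually-all hs in
  M ⊔ₙ N , λ m le → h m (m⊔n≤o⇒m≤o M N le) ∷ hs′ m (m⊔n≤o⇒n≤o M N le)

-- Finiteness through covering lists.

module Listings {a b} (S : Setoid a b) where
  open Setoid S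
  open Cardinality S

  -- A covering list may repeat entries or contain extra ones, so it is easier to produce than an
  -- exact enumeration; classically it suffices when `P` respects `_≈_`.
  Listed : ∀ {p} → Pred Carrier p → Set (a ⊔ b ⊔ p)
  Listed P = ∃[ l ] ∀ x → P x → Any (x ≈_) l

  Finite⇒Listed : ∀ {p} {P : Pred Carrier p} → Finite P → Listed P
  Finite⇒Listed (n , e , _ , h) = tabulate e , λ x px →
    let i , x≈ = Equivalence.to (h x) px in Any.tabulate⁺ i x≈

  fresh⇒injective : ∀ (x : ℕ → Carrier) → (∀ n → ¬ Any (x n ≈_) (prefix x n)) →
    Injective _≡_ _≈_ x
  fresh⇒injective x fresh {m} {n} e with <-cmp m n
  ... | tri< m<n _ _ = ⊥-elim (fresh n (prefix⁺ x m<n (sym e)))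
  ... | tri≈ _ m≡n _ = m≡n
  ... | tri> _ _ n<m = ⊥-elim (fresh m (prefix⁺ x n<m e))

  list-pigeonhole : ∀ l (x : ℕ → Carrier) → (∀ i → i ≤ length l → Any (x i ≈_) l) →
    ∃[ i ] ∃[ j ] i < j × x i ≈ x j
  list-pigeonhole l x h =
    let m = λ (i : Fin (suc (length l))) → h (toℕ i) (s≤s⁻¹ (toℕ<n i))
        i , j , i<j , e = pigeonhole (n<1+n (length l)) (index ∘ m)
    in toℕ i , toℕ j , i<j ,
       trans (Any.lookup-index (m i))
         (≡.subst (λ k → lookup l k ≈ x (toℕ j)) (≡.sym e) (sym (Any.lookup-index (m j))))

  module _ (em : ∀ a → ExcludedMiddle a) where
    open Classical em

    -- Otherwise the `length l + 1` terms from `x N` on all lie in `l`, and two of them coincide.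
    injective⇒escapes : ∀ {x : ℕ → Carrier} → Injective _≡_ _≈_ x →
      ∀ l N → ∃[ n ] N ≤ n × ¬ Any (x n ≈_) l
    injective⇒escapes {x} inj l N = by-contradiction λ none →
      let i , j , i<j , e = list-pigeonhole l (λ i → x (N + i)) λ i _ →
            by-contradiction λ x∉ → none (N + i , m≤m+n N i , x∉)
      in <⇒≢ i<j (+-cancelˡ-≡ N i j (inj e))

    -- The head `y` is removed from `P` before recursing, so putting it back in front keeps the
    -- enumeration injective.
    listed-by⇒Finite : ∀ {p} {P : Pred Carrier p} → P Respects _≈_ →
      ∀ l → (∀ x → P x → Any (x ≈_) l) → Finite P
    listed-by⇒Finite resp [] h =
      0 , (λ ()) , (λ { {()} }) , λ x → mk⇔ (λ px → contradiction (h x px) λ ()) λ ()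
    listed-by⇒Finite {P = P} resp (y ∷ l) h
      with listed-by⇒Finite {P = λ x → P x × ¬ x ≈ y}
             (λ e (px , x≉y) → resp e px , λ x′≈y → x≉y (trans e x′≈y))
             l (λ x (px , x≉y) → drop x≉y (h x px))
         | em _ {P y}
      where
      drop : ∀ {x} → ¬ x ≈ y → Any (x ≈_) (y ∷ l) → Any (x ≈_) l
      drop x≉y (here x≈y) = contradiction x≈y x≉y
      drop x≉y (there m)  = m
    ... | n , e , inj , g | no ¬py = n , e , inj , λ x → mk⇔
      (λ px → Equivalence.to (g x) (px , λ x≈y → ¬py (resp x≈y px)))
      (λ i → proj₁ (Equivalence.from (g x) i))
    ... | n , e , inj , g | yes py = suc n , e′ , inj′ , λ x → mk⇔ (to x) (from x)
      where
      e′ : Fin (suc n) → Carrier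
      e′ zero    = y
      e′ (suc i) = e i
      e≉y : ∀ i → ¬ e i ≈ y
      e≉y i = proj₂ (Equivalence.from (g (e i)) (i , refl))
      inj′ : Injective _≡_ _≈_ e′
      inj′ {zero}  {zero}  _ = ≡.refl
      inj′ {zero}  {suc j} q = contradiction (sym q) (e≉y j)
      inj′ {suc i} {zero}  q = contradiction q (e≉y i)
      inj′ {suc i} {suc j} q = ≡.cong suc (inj q)
      to : ∀ x → P x → ∃[ i ] x ≈ e′ i
      to x px with em _ {x ≈ y}
      ... | yes x≈y = zero , x≈y
      ... | no x≉y  = let i , q = Equivalence.to (g x) (px , x≉y) in suc i , q
      from : ∀ x → (∃[ i ] x ≈ e′ i) → P x
      from x (zero , q)  = resp (sym q) py
      from x (suc i , q) = proj₁ (Equivalence.from (g x) (i , q))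

    Listed⇒Finite : ∀ {p} {P : Pred Carrier p} → P Respects _≈_ → Listed P → Finite P
    Listed⇒Finite resp (l , h) = listed-by⇒Finite resp l h

    pick-fresh : ∀ {p} {P : Pred Carrier p} → P Respects _≈_ → Infinite P →
      ∀ l → ∃[ x ] P x × ¬ Any (x ≈_) l
    pick-fresh resp inf l = by-contradiction λ none → inf (Listed⇒Finite resp
      (l , λ x px → by-contradiction λ x∉ → none (x , px , x∉)))

    abstract
      injective-choice : ∀ {p} (Q : List Carrier → Pred Carrier p) →
        (∀ l → Q l Respects _≈_) → (∀ l → Along Q l → Infinite (Q l)) →
        ∃[ x ] Injective _≡_ _≈_ x × (∀ n → Q (prefix x n) (x n))
      injective-choice Q resp inf =
        let x , h = dependent-choice (λ l y → Q l y × ¬ Any (y ≈_) l)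
                      λ l al → pick-fresh (resp l) (inf l (along al)) l
        in x , fresh⇒injective x (proj₂ ∘ h) , proj₁ ∘ h
        where
        along : ∀ {l} → Along (λ l y → Q l y × ¬ Any (y ≈_) l) l → Along Q l
        along {[]}    _             = tt
        along {y ∷ l} ((q , _) , h) = q , along h

-- Thin and sparse sets: parts (i) and (ii).

module ThinSparse (em : ∀ a → ExcludedMiddle a) {c ℓ} (G : Group c ℓ) where
  open Group G
  open GroupProperties G
  open SubsetsOf G
  open Subset
  open Listings setoid
  open Classical em

  ∈⊲⁺ : ∀ {g x} A → g ⁻¹ ∙ x ∈ A → x ∈ g ⊲ A
  ∈⊲⁺ {g} {x} A h = g ⁻¹ ∙ x , h , sym (\\-leftDividesˡ g x)

  ∈⊲⁻ : ∀ {g x} A → x ∈ g ⊲ A → g ⁻¹ ∙ x ∈ A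
  ∈⊲⁻ {g} A (a , aA , e) = respects A (sym (trans (∙-congˡ e) (\\-leftDividesʳ g a))) aA

  ⊲-congˡ : ∀ {g h x} A → g ≈ h → x ∈ g ⊲ A → x ∈ h ⊲ A
  ⊲-congˡ A e (a , aA , x≈) = a , aA , trans x≈ (∙-congʳ e)

  module _ {n : ℕ} (A : Subset) where

    -- As `x ∈ gA` means `g⁻¹x ∈ A`, the inverses of the witnesses `g i` form `F`, and the `x k` are
    -- drawn from the infinite intersection.
    ¬Thin⇒ : ¬ Thin n A →
      ∃[ F ] (_∈ F) HasSize (suc n) × ∃[ x ] InjectiveSeq x × (∀ k → F ⊳ x k ⊆ A)
    ¬Thin⇒ ¬thin =
      let g , h           = ¬∀⇒∃¬ ¬thin
          g-inj , inf     = ¬→ h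
          x , x-inj , x∈  = injective-choice em (λ _ x → ∀ i → x ∈ g i ⊲ A)
            (λ _ e h i → respects (g i ⊲ A) e (h i)) λ _ _ → inf
          F = record
            { pred     = λ x → Lift c (∃[ i ] x ≈ g i ⁻¹)
            ; respects = λ { e (lift (i , x≈)) → lift (i , trans (sym e) x≈) }
            }
      in F , ((λ i → g i ⁻¹) , g-inj ∘ ⁻¹-injective , λ x → mk⇔ lower lift) , x , x-inj ,
        λ { k z (a , lift (i , a≈) , z≈) →
          respects A (sym (trans z≈ (∙-congʳ a≈))) (∈⊲⁻ A (x∈ k i)) }

    ⇒¬Thin : (∃[ F ] (_∈ F) HasSize (suc n) × ∃[ x ] InjectiveSeq x × (∀ k → F ⊳ x k ⊆ A)) →
      ¬ Thin n A
    ⇒¬Thin (F , (e , e-inj , e-F) , x , x-inj , Fx⊆A) thin =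
      let l , h       = Finite⇒Listed (thin (λ i → e i ⁻¹) (e-inj ∘ ⁻¹-injective))
          k , _ , x∉l = injective⇒escapes em x-inj l 0
      in x∉l (h (x k) λ i → e i ∙ x k
                , Fx⊆A k _ (e i , Equivalence.from (e-F (e i)) (i , refl) , refl)
                , sym (\\-leftDividesʳ (e i) (x k)))

  module _ (A : Subset) where

    -- With distinct `x n` in a bad `X`, the element `y m` is drawn from the infinite intersection
    -- of `x n ⊲ A` over `n ≤ m`; the answer uses the inverses of the `x n`.
    ¬Sparse⇒ : ¬ Sparse A →
      ∃[ x ] ∃[ y ] InjectiveSeq x × InjectiveSeq y × (∀ n m → n ≤ m → (x n ∙ y m) ∈ A)
    ¬Sparse⇒ ¬sparse =
      let X , h            = ¬∀⇒∃¬ ¬sparse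
          X-inf , none     = ¬→ h
          x , x-inj , x∈X  = injective-choice em (λ _ → _∈ X) (λ _ → respects X) λ _ _ → X-inf
          F : ℕ → Subset
          F m = record
            { pred     = λ z → Lift c (∃[ n ] n ≤ m × z ≈ x n)
            ; respects = λ { e (lift (n , n≤m , z≈)) → lift (n , n≤m , trans (sym e) z≈) }
            }
          F-fin : ∀ m → Finite (_∈ F m)
          F-fin m = Listed⇒Finite em (respects (F m))
            (prefix x (suc m) , λ { z (lift (n , n≤m , z≈)) → prefix⁺ x (s≤s n≤m) z≈ })
          y , y-inj , y∈   = injective-choice em
            (λ l z → ∀ g → g ∈ F (length l) → z ∈ g ⊲ A)
            (λ l e h g gF → respects (g ⊲ A) e (h g gF))
            λ l _ fin → none (F (length l)
                             , (λ { z (lift (n , _ , z≈)) → respects X (sym z≈) (x∈X n) })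
                             , F-fin (length l) , fin)
      in (λ n → x n ⁻¹) , y , x-inj ∘ ⁻¹-injective , y-inj , λ n m n≤m →
        ∈⊲⁻ A (y∈ m (x n) (lift (n , ≡.subst (n ≤_) (≡.sym (length-prefix y m)) n≤m , refl)))

    -- For finite `F` inside the set `X` of all `x n ⁻¹`, almost every `y m` lies in each `g ⊲ A`
    -- with `g ∈ F`, so the intersection is infinite.
    ⇒¬Sparse : (∃[ x ] ∃[ y ] InjectiveSeq x × InjectiveSeq y ×
      (∀ n m → n ≤ m → (x n ∙ y m) ∈ A)) → ¬ Sparse A
    ⇒¬Sparse (x , y , x-inj , y-inj , xy∈A) sparse =
      let F , F⊆X , F-fin , fin = sparse X X-inf
          l , in-l = Finite⇒Listed F-fin
          l′ , in-l′ = Finite⇒Listed fin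
          N , ev = eventually-all (All.universal eventually l)
          m , N≤m , y∉l′ = injective⇒escapes em y-inj l′ N
      in y∉l′ (in-l′ (y m) λ g gF →
           let h = All.lookupAny (ev m N≤m) (in-l g gF)
           in ⊲-congˡ A (sym (proj₂ h)) (proj₁ h (respects X (proj₂ h) (F⊆X g gF))))
      where
      X : Subset
      X = record
        { pred     = λ z → Lift c (∃[ n ] z ≈ x n ⁻¹)
        ; respects = λ { e (lift (n , z≈)) → lift (n , trans (sym e) z≈) }
        }
      X-inf : Infinite (_∈ X)
      X-inf fin = let l , h       = Finite⇒Listed fin
                      n , _ , x∉l = injective⇒escapes em (x-inj ∘ ⁻¹-injective) l 0
                  in x∉l (h _ (lift (n , refl)))
      -- The list for `F` is only known to cover it, so membership of `z` in `X` is a hypothesis.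
      eventually : ∀ z → ∃[ N ] ∀ m → N ≤ m → z ∈ X → y m ∈ z ⊲ A
      eventually z with em _ {z ∈ X}
      ... | yes (lift (n , z≈)) = n , λ m n≤m _ → ⊲-congˡ A (sym z≈)
        (x n ∙ y m , xy∈A n m n≤m , sym (\\-leftDividesʳ (x n) (y m)))
      ... | no z∉X = 0 , λ _ _ z∈X → contradiction z∈X z∉X

-- Finite products and recurrent subsets: part (iv).

linked-∷ʳ : ∀ {a r} {A : Set a} {R : A → A → Set r} xs {y z} →
  Linked R (xs ∷ʳ y) → R y z → Linked R (xs ∷ʳ y ∷ʳ z)
linked-∷ʳ []            [-]      r = r ∷ [-]
linked-∷ʳ (_ ∷ [])      (q ∷ qs) r = q ∷ linked-∷ʳ [] qs r
linked-∷ʳ (_ ∷ x ∷ xs)  (q ∷ qs) r = q ∷ linked-∷ʳ (x ∷ xs) qs r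

map-prefix : ∀ {a b} {A : Set a} {B : Set b} (f : A → B) x n →
  map f (prefix x n) ≡ prefix (f ∘ x) n
map-prefix f x zero    = ≡.refl
map-prefix f x (suc n) = ≡.cong (f (x n) ∷_) (map-prefix f x n)

module Recurrence (em : ∀ a → ExcludedMiddle a) {c ℓ} (G : Group c ℓ) where
  open Group G
  open GroupProperties G
  open SubsetsOf G
  open Subset
  open Listings setoid
  open ThinSparse em G using (∈⊲⁺; ∈⊲⁻)
  open Classical em
  open SetoidReasoning setoid

  ∈⊳⁺ : ∀ {g x} B → x ∙ g ⁻¹ ∈ B → x ∈ B ⊳ g
  ∈⊳⁺ {g} {x} B h = x ∙ g ⁻¹ , h , sym (//-rightDividesˡ g x)

  ∈⊳⁻ : ∀ {g x} B → x ∈ B ⊳ g → x ∙ g ⁻¹ ∈ B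
  ∈⊳⁻ {g} B (a , aB , e) = respects B (sym (trans (∙-congʳ e) (//-rightDividesʳ g a))) aB

  -- A prefix lists the newest term first, so products run from the last entry to the first.
  products : List Carrier → List Carrier
  products []      = ε ∷ []
  products (y ∷ l) = products l ++ map (_∙ y) (products l)

  ε∈products : ∀ l → ε ∈ₗ products l
  ε∈products []      = here ≡.refl
  ε∈products (y ∷ l) = ∈-++⁺ˡ (ε∈products l)

  ∙∈products : ∀ l {u y} → u ∈ₗ products l → u ∙ y ∈ₗ products (y ∷ l)
  ∙∈products l m = ∈-++⁺ʳ (products l) (∈-map⁺ (_∙ _) m)

  products-mono : ∀ h {m n u} → m ≤ n →
    u ∈ₗ products (prefix h m) → u ∈ₗ products (prefix h n)
  products-mono h {m} {n} m≤n u∈ with m≤n⇒m<n∨m≡n m≤n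
  ... | inj₂ ≡.refl = u∈
  products-mono h {m} {suc n} _ u∈ | inj₁ m<1+n = ∈-++⁺ˡ (products-mono h (s≤s⁻¹ m<1+n) u∈)

  prod-∷ʳ : ∀ h l k → prod h (l ∷ʳ k) ≈ prod h l ∙ h k
  prod-∷ʳ h []      k = trans (identityʳ _) (sym (identityˡ _))
  prod-∷ʳ h (i ∷ l) k = trans (∙-congˡ (prod-∷ʳ h l k)) (sym (assoc _ _ _))

  -- `u` accumulates the factors already read; since the indices increase, it stays a product over a
  -- prefix.
  products-prod : ∀ h (P : Pred Carrier (c ⊔ ℓ)) → P Respects _≈_ →
    (∀ n u → u ∈ₗ products (prefix h n) → P u) →
    ∀ l {i u} → u ∈ₗ products (prefix h i) → Linked _<_ (i ∷ l) → P (u ∙ prod h (i ∷ l))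
  products-prod h P resp base [] {i} u∈ _ =
    resp (∙-congˡ (sym (identityʳ (h i)))) (base (suc i) _ (∙∈products (prefix h i) u∈))
  products-prod h P resp base (j ∷ l) {i} u∈ (i<j ∷ lk) =
    resp (assoc _ _ _) (products-prod h P resp base l (products-mono h i<j (∙∈products (prefix h i) u∈)) lk)

  FP-products : ∀ h (P : Pred Carrier (c ⊔ ℓ)) → P Respects _≈_ →
    (∀ n u → u ∈ₗ products (prefix h n) → P u) → ∀ {z} → z ∈ FP h → P z
  FP-products h P resp base ([] , j , lk , lift z≈) = resp (trans (identityˡ _) (sym z≈))
    (products-prod h P resp base [] (ε∈products (prefix h j)) lk)
  FP-products h P resp base (i ∷ is , j , lk , lift z≈) = resp (trans (identityˡ _) (sym z≈))
    (products-prod h P resp base (is ∷ʳ j) (ε∈products (prefix h i)) lk)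

  module _ (A : Subset) where

    recurrent⇒FP : (∃[ B ] B ⊆ A × (∃[ b ] b ∈ B) × Recurrent B) →
      ∃[ x ] x ∈ A × ∃[ Y ] IsFPSet Y × (x ⊲ Y) ⊆ A
    recurrent⇒FP (B , B⊆A , (b , bB) , rec) =
      let h , h-inj , hQ = injective-choice em Q Q-resp Q-inf
      in b , B⊆A b bB , FP h , (h , h-inj , λ _ → mk⇔ id id) , λ z (y , yFP , z≈) →
        B⊆A z (respects B (sym z≈)
          (FP-products h (λ u → b ∙ u ∈ B) (λ e → respects B (∙-congˡ e))
            (λ n u u∈ → All.lookup (along (prefix h n) (along-prefix Q hQ n)) u∈) yFP))
      where
      Q : List Carrier → Pred Carrier (c ⊔ ℓ)
      Q l y = All (λ u → b ∙ (u ∙ y) ∈ B) (products l)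
      Q-resp : ∀ l → Q l Respects _≈_
      Q-resp l e = All.map (respects B (∙-congˡ (∙-congˡ e)))
      along : ∀ l → Along Q l → All (λ u → b ∙ u ∈ B) (products l)
      along []      _        = respects B (sym (identityʳ b)) bB ∷ []
      along (y ∷ l) (q , qs) = All.++⁺ (along l qs) (All.map⁺ q)
      Q-inf : ∀ l → Along Q l → Infinite (Q l)
      -- With `P` the products of `l`, `U` says that `bP` lies in the set, which fixes finitely many
      -- coordinates. Since `bP ⊆ Bg` means `bPg⁻¹ ⊆ B`, the return times are inverses of
      -- candidates.
      Q-inf l al fin = rec U
        ( (λ B≐B′ → All.map (Equivalence.to (B≐B′ _)))
        , U
        , (λ B₀ u → map (b ∙_) (products l) , λ B′ agree →
            All.zipWith (λ (f , m) → Equivalence.to f m) (All.map⁻ agree , u))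
        , along l al
        , λ _ → id )
        (Listed⇒Finite em
          (λ e → All.map λ m → ∈⊳⁺ B (respects B (∙-congˡ (⁻¹-cong e)) (∈⊳⁻ B m)))
          (let L , in-L = Finite⇒Listed fin in map _⁻¹ L , λ g u →
            Any.map⁺ (Any.map (λ e → trans (sym (⁻¹-involutive g)) (⁻¹-cong e))
              (in-L (g ⁻¹) (All.map (λ m → respects B (assoc _ _ _) (∈⊳⁻ B m)) u)))))
        where
        U : Pred Subset (c ⊔ ℓ)
        U B′ = All (λ u → b ∙ u ∈ B′) (products l)

  -- Recurrence of the set generated by a generic sequence.

  Generic : List Carrier → Pred Carrier (c ⊔ ℓ)
  Generic P z = ∀ {p q r t} → p ∈ₗ P → q ∈ₗ P → r ∈ₗ P → t ∈ₗ P →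
    ¬ z ≈ p ⁻¹ ∙ (q ∙ (r ⁻¹ ∙ t))

  -- Only finitely many words are forbidden, and an injective sequence leaves any finite list.
  generic-beyond : ∀ {g} → InjectiveSeq g → ∀ P N → ∃[ n ] N ≤ n × Generic P (g n)
  generic-beyond {g} g-inj P N =
    let n , N≤n , n∉ = injective⇒escapes em g-inj words N
    in n , N≤n , λ p q r t e → n∉ (lose
      (∈-cartesianProductWith⁺ (λ p w → p ⁻¹ ∙ w) p
        (∈-cartesianProductWith⁺ _∙_ q (∈-cartesianProductWith⁺ (λ r t → r ⁻¹ ∙ t) r t))) e)
    where
    words : List Carrier
    words = cartesianProductWith (λ p w → p ⁻¹ ∙ w) P
      (cartesianProductWith _∙_ P (cartesianProductWith (λ r t → r ⁻¹ ∙ t) P P))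

  -- This is `FP h` together with `ε`, up to `_≈_`.
  Generated : (ℕ → Carrier) → Subset
  Generated h = record
    { pred     = λ z → ∃[ n ] ∃[ u ] u ∈ₗ products (prefix h n) × z ≈ u
    ; respects = λ { e (n , u , u∈ , z≈) → n , u , u∈ , trans (sym e) z≈ }
    }

  generated : ∀ h n {u z} → u ∈ₗ products (prefix h n) → z ≈ u → z ∈ Generated h
  generated h n u∈ z≈ = n , _ , u∈ , z≈

  module _ {h : ℕ → Carrier} (h-gen : ∀ n → Generic (products (prefix h n)) (h n)) where

    private
      S : ℕ → List Carrier
      S n = products (prefix h n)

    -- List membership is up to `_≡_`, so `h m` occurs as the literal product `ε ∙ h m`.
    entry∈ : ∀ {m n} → m < n → ε ∙ h m ∈ₗ S n
    entry∈ {m} m<n = products-mono h m<n (∙∈products (prefix h m) (ε∈products (prefix h m)))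

    -- If w hₘ and w hₙ are both generated and n is large, then genericity forces the
    -- last factor of w hₙ to be hₙ, which cancels.
    translates-leave : ∀ w → ¬ w ∈ Generated h →
      ∃[ N ] ∀ n → N ≤ n → ¬ w ∙ h n ∈ Generated h
    translates-leave w w∉ with em _ {∃[ m ] w ∙ h m ∈ Generated h}
    ... | no none = 0 , λ n _ wh∈ → none (n , wh∈)
    -- From this threshold on, both `h m` and `u₀` are products of terms before `n`.
    ... | yes (m , k , u₀ , u₀∈ , wh≈u₀) = suc m ⊔ₙ k , λ n le → λ (l , u , u∈ , wh≈u) →
        descend n (m⊔n≤o⇒m≤o (suc m) k le) (products-mono h (m⊔n≤o⇒n≤o (suc m) k le) u₀∈) l u∈ wh≈u
      where
      w≈ : w ≈ u₀ ∙ (ε ∙ h m) ⁻¹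
      w≈ = begin
        w                    ≈⟨ //-rightDividesʳ (h m) w ⟨
        w ∙ h m ∙ h m ⁻¹     ≈⟨ ∙-cong wh≈u₀ (⁻¹-cong (sym (identityˡ _))) ⟩
        u₀ ∙ (ε ∙ h m) ⁻¹    ∎
      w⁻¹≈ : w ⁻¹ ≈ ε ⁻¹ ∙ ((ε ∙ h m) ∙ u₀ ⁻¹)
      w⁻¹≈ = begin
        w ⁻¹                           ≈⟨ ⁻¹-cong w≈ ⟩
        (u₀ ∙ (ε ∙ h m) ⁻¹) ⁻¹         ≈⟨ ⁻¹-anti-homo-// u₀ (ε ∙ h m) ⟩
        (ε ∙ h m) ∙ u₀ ⁻¹              ≈⟨ identityˡ _ ⟨
        ε ∙ ((ε ∙ h m) ∙ u₀ ⁻¹)        ≈⟨ ∙-congʳ ε⁻¹≈ε ⟨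
        ε ⁻¹ ∙ ((ε ∙ h m) ∙ u₀ ⁻¹)     ∎
      descend : ∀ n → m < n → u₀ ∈ₗ S n → ∀ l {u} → u ∈ₗ S l → ¬ w ∙ h n ≈ u
      descend n m<n u₀∈n l {u} u∈ wh≈u with l ≤? n
      ... | yes l≤n = h-gen n (ε∈products (prefix h n)) (entry∈ m<n) u₀∈n (products-mono h l≤n u∈) (begin
        h n                                    ≈⟨ \\-leftDividesʳ w (h n) ⟨
        w ⁻¹ ∙ (w ∙ h n)                       ≈⟨ ∙-cong w⁻¹≈ wh≈u ⟩
        ε ⁻¹ ∙ ((ε ∙ h m) ∙ u₀ ⁻¹) ∙ u         ≈⟨ assoc _ _ _ ⟩
        ε ⁻¹ ∙ ((ε ∙ h m) ∙ u₀ ⁻¹ ∙ u)         ≈⟨ ∙-congˡ (assoc _ _ _) ⟩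
        ε ⁻¹ ∙ ((ε ∙ h m) ∙ (u₀ ⁻¹ ∙ u))       ∎)
      descend n m<n u₀∈n zero    u∈ wh≈u | no l≰n = contradiction z≤n l≰n
      descend n m<n u₀∈n (suc l) u∈ wh≈u | no l≰n with ∈-++⁻ (S l) u∈
      ... | inj₁ u∈l = descend n m<n u₀∈n l u∈l wh≈u
      ... | inj₂ u∈′ with ∈-map⁻ (_∙ h l) u∈′
      ... | v , v∈ , ≡.refl with m≤n⇒m<n∨m≡n (s≤s⁻¹ (≰⇒> l≰n))
      ...   | inj₂ ≡.refl = w∉ (generated h l v∈ (∙-cancelʳ (h l) w v wh≈u))
      -- If the last factor `h l` comes after `h n`, solving for it gives a word forbidden by
      -- genericity.
      ...   | inj₁ n<l = h-gen l v∈ (products-mono h (≤-trans (n≤1+n n) n<l) u₀∈n)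
        (entry∈ (≤-trans m<n (≤-trans (n≤1+n n) n<l))) (entry∈ n<l) (begin
        h l                                    ≈⟨ \\-leftDividesʳ v (h l) ⟨
        v ⁻¹ ∙ (v ∙ h l)                       ≈⟨ ∙-congˡ wh≈u ⟨
        v ⁻¹ ∙ (w ∙ h n)                       ≈⟨ ∙-congˡ (∙-cong w≈ (sym (identityˡ (h n)))) ⟩
        v ⁻¹ ∙ (u₀ ∙ (ε ∙ h m) ⁻¹ ∙ (ε ∙ h n)) ≈⟨ ∙-congˡ (assoc _ _ _) ⟩
        v ⁻¹ ∙ (u₀ ∙ ((ε ∙ h m) ⁻¹ ∙ (ε ∙ h n))) ∎)

    -- Each coordinate `e` is eventually preserved by `h n ⁻¹`: a member stays because `h n` can be
    -- appended as last factor, a non-member by `translates-leave`.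
    recurrent : ∀ x → InjectiveSeq h → Recurrent (x ⊲ Generated h)
    recurrent x h-inj U (_ , V , V-open , VB , V⊆U) fin =
      let xs , stable = V-open B VB
          N , ev      = eventually-all (All.universal eventually xs)
          l , in-l    = Finite⇒Listed fin
          n , N≤n , n∉l = injective⇒escapes em (h-inj ∘ ⁻¹-injective) l N
      in n∉l (in-l (h n ⁻¹) (V⊆U _ (stable (B ⊳ h n ⁻¹) (ev n N≤n))))
      where
      B : Subset
      B = x ⊲ Generated h
      move⁺ : ∀ {e n} → x ⁻¹ ∙ e ∙ h n ∈ Generated h → e ∈ B ⊳ h n ⁻¹
      move⁺ {e} {n} m = ∈⊳⁺ B (∈⊲⁺ (Generated h) (respects (Generated h)
        (trans (assoc _ _ _) (∙-congˡ (∙-congˡ (sym (⁻¹-involutive (h n)))))) m))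
      move⁻ : ∀ {e n} → e ∈ B ⊳ h n ⁻¹ → x ⁻¹ ∙ e ∙ h n ∈ Generated h
      move⁻ {e} {n} m = respects (Generated h)
        (trans (∙-congˡ (∙-congˡ (⁻¹-involutive (h n)))) (sym (assoc _ _ _)))
        (∈⊲⁻ (Generated h) (∈⊳⁻ B m))
      eventually : ∀ e → ∃[ N ] ∀ n → N ≤ n → e ∈ B ⇔ e ∈ B ⊳ h n ⁻¹
      eventually e with em _ {x ⁻¹ ∙ e ∈ Generated h}
      ... | yes e∈@(k , u , u∈ , e≈) = k , λ n k≤n → mk⇔
        (λ _ → move⁺ (generated h (suc n) (∙∈products (prefix h n) (products-mono h k≤n u∈)) (∙-congʳ e≈)))
        (λ _ → ∈⊲⁺ (Generated h) e∈)
      ... | no e∉ = let N , leave = translates-leave _ e∉ in N , λ n N≤n → mk⇔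
        (λ m → contradiction (∈⊲⁻ (Generated h) m) e∉)
        (λ m → contradiction (move⁻ m) (leave n N≤n))

  -- Increasing indices keep products of the subsequence inside `FP g`; genericity gives recurrence.
  Growing : (ℕ → Carrier) → List ℕ → Pred ℕ (c ⊔ ℓ)
  Growing g l m = All (_< m) l × Generic (products (map g l)) (g m)

  -- The clause `j ∈ₗ l` makes the last index smaller than the next one, so the induction can
  -- append.
  growing-products : ∀ g l → Along (Growing g) l → ∀ {u} → u ∈ₗ products (map g l) →
    u ≈ ε ⊎ ∃[ is ] ∃[ j ] Linked _<_ (is ∷ʳ j) × j ∈ₗ l × u ≈ prod g (is ∷ʳ j)
  growing-products g [] _ (here ≡.refl) = inj₁ refl
  growing-products g (m ∷ l) ((lt , _) , al) u∈ with ∈-++⁻ (products (map g l)) u∈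
  ... | inj₁ u∈l with growing-products g l al u∈l
  ...   | inj₁ u≈ = inj₁ u≈
  ...   | inj₂ (is , j , lk , j∈ , u≈) = inj₂ (is , j , lk , there j∈ , u≈)
  growing-products g (m ∷ l) ((lt , _) , al) u∈ | inj₂ u∈′ with ∈-map⁻ (_∙ g m) u∈′
  ... | v , v∈ , ≡.refl with growing-products g l al v∈
  ...   | inj₁ v≈ = inj₂ ([] , m , [-] , here ≡.refl ,
            trans (∙-congʳ v≈) (trans (identityˡ _) (sym (identityʳ _))))
  ...   | inj₂ (is , j , lk , j∈ , v≈) = inj₂ (is ∷ʳ j , m ,
            linked-∷ʳ is lk (All.lookup lt j∈) , here ≡.refl ,
            trans (∙-congʳ v≈) (sym (prod-∷ʳ g (is ∷ʳ j) m)))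

  module _ (g : ℕ → Carrier) (φ : ℕ → ℕ) (gr : ∀ n → Growing g (prefix φ n) (φ n)) where

    growing⇒generic : ∀ n → Generic (products (prefix (g ∘ φ) n)) (g (φ n))
    growing⇒generic n = ≡.subst (λ l → Generic (products l) (g (φ n))) (map-prefix g φ n) (proj₂ (gr n))

    growing⇒injective : ∀ {m n} → φ m ≡ φ n → m ≡ n
    growing⇒injective = Listings.fresh⇒injective (≡.setoid ℕ) φ λ n →
      All.All¬⇒¬Any (All.map >⇒≢ (proj₁ (gr n)))

    generated⇒FP : ∀ {z} → z ∈ Generated (g ∘ φ) → z ≈ ε ⊎ z ∈ FP g
    generated⇒FP {z} (n , u , u∈ , z≈) = Sum.map (trans z≈)
      (λ { (is , j , lk , _ , u≈) → is , j , lk , lift (trans z≈ u≈) })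
      (growing-products g (prefix φ n) (along-prefix (Growing g) gr n)
        (≡.subst (λ l → u ∈ₗ products l) (≡.sym (map-prefix g φ n)) u∈))

  growing-subsequence : ∀ {g} → InjectiveSeq g → ∃[ φ ] ∀ n → Growing g (prefix φ n) (φ n)
  growing-subsequence {g} g-inj = dependent-choice (Growing g) λ l _ →
    let N , above     = eventually-all {R = λ i m → i < m} (All.universal (λ i → suc i , λ _ → id) l)
        m , N≤m , gen = generic-beyond g-inj (products (map g l)) N
    in m , above m N≤m , gen

  module _ (A : Subset) where

    generated-subset : ∀ {x Y g φ} → x ∈ A → Y ≐ FP g → x ⊲ Y ⊆ A →
      (∀ n → Growing g (prefix φ n) (φ n)) → x ⊲ Generated (g ∘ φ) ⊆ A
    generated-subset {x} {Y} {g} {φ} xA Y≐FP xY⊆A gr z (y , yG , z≈) =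
      [ (λ y≈ε → respects A (sym (trans z≈ (trans (∙-congˡ y≈ε) (identityʳ x)))) xA)
      , (λ yFP → xY⊆A z (y , Equivalence.from (Y≐FP y) yFP , z≈))
      ]′ (generated⇒FP g φ gr yG)

    FP⇒recurrent : (∃[ x ] x ∈ A × ∃[ Y ] IsFPSet Y × (x ⊲ Y) ⊆ A) →
      ∃[ B ] B ⊆ A × (∃[ b ] b ∈ B) × Recurrent B
    FP⇒recurrent (x , xA , Y , (g , g-inj , Y≐FP) , xY⊆A) = build (growing-subsequence g-inj)
      where
      build : (∃[ φ ] ∀ n → Growing g (prefix φ n) (φ n)) →
        ∃[ B ] B ⊆ A × (∃[ b ] b ∈ B) × Recurrent B
      build (φ , gr) =
          x ⊲ Generated (g ∘ φ)
        , generated-subset {x} {Y} {g} {φ} xA Y≐FP xY⊆A gr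
        , (x ∙ ε , ε , generated (g ∘ φ) 0 (here ≡.refl) refl , refl)
        , recurrent {g ∘ φ} (growing⇒generic g φ gr) x (growing⇒injective g φ gr ∘ g-inj)

-- Translates of ultrafilters and freeness of the action.

module Ultrafilters
  (em : ∀ a → ExcludedMiddle a) (fe : ∀ a b → Extensionality a b) {c ℓ} (G : Group c ℓ)
  where
  open Group G
  open GroupProperties G
  open SubsetsOf G
  open Subset
  open Ultrafilter
  open Listings setoid
  open Classical em

  -- The translate `g⁻¹X`: `X` belongs to `gp` exactly when `pre g X` belongs to `p`.
  pre : Carrier → Subset → Subset
  pre g X = record
    { pred     = λ x → g ∙ x ∈ X
    ; respects = λ e → respects X (∙-congˡ e)
    }

  without : Carrier → Subset
  without y = record
    { pred     = λ x → Lift c (¬ x ≈ y)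
    ; respects = λ { e (lift x≉y) → lift λ x′≈y → x≉y (trans e x′≈y) }
    }

  ⋂ : List Subset → Subset
  ⋂ = foldr _∩_ full

  ∈⋂⁻ : ∀ {x l P} → x ∈ ⋂ l → P ∈ₗ l → x ∈ P
  ∈⋂⁻ (x∈ , _) (here ≡.refl) = x∈
  ∈⋂⁻ (_ , x∈) (there m)     = ∈⋂⁻ x∈ m

  ∈⊲ᵤ⁺ : ∀ p g X → pre g X ∈ᵤ p → X ∈ᵤ g ⊲ᵤ p
  ∈⊲ᵤ⁺ p g X h = pre g X , h , λ x → mk⇔
    (λ xX → g ⁻¹ ∙ x , respects X (sym (\\-leftDividesˡ g x)) xX , sym (\\-leftDividesˡ g x))
    (λ (a , ga∈ , x≈) → respects X (sym x≈) ga∈)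

  ∈⊲ᵤ⁻ : ∀ p g X → X ∈ᵤ g ⊲ᵤ p → pre g X ∈ᵤ p
  ∈⊲ᵤ⁻ p g X (P , P∈p , X≐gP) =
    upward p (λ x xP → Equivalence.from (X≐gP (g ∙ x)) (x , xP , refl)) P∈p

  pre-congˡ : ∀ {p g h} X → g ≈ h → pre g X ∈ᵤ p → pre h X ∈ᵤ p
  pre-congˡ {p} X e = upward p λ x → respects X (∙-congʳ e)

  ⊲ᵤ-congˡ : ∀ {p g h} → g ≈ h → g ⊲ᵤ p ≈ᵤ h ⊲ᵤ p
  ⊲ᵤ-congˡ {p} {g} {h} e X = mk⇔
    (∈⊲ᵤ⁺ p h X ∘ pre-congˡ {p} X e ∘ ∈⊲ᵤ⁻ p g X)
    (∈⊲ᵤ⁺ p g X ∘ pre-congˡ {p} X (sym e) ∘ ∈⊲ᵤ⁻ p h X)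

  module _ (p : Ultrafilter) where

    inhabited : ∀ P → P ∈ᵤ p → ∃[ x ] x ∈ P
    inhabited P P∈p = by-contradiction λ none →
      proper p (upward p {P} {∅} (λ x xP → ⊥-elim (none (x , xP))) P∈p)

    ∁∉ : ∀ {P} → P ∈ᵤ p → ¬ ∁ P ∈ᵤ p
    ∁∉ {P} P∈p ∁P∈p = let x , xP , x∉P = inhabited (P ∩ ∁ P) (meet p P∈p ∁P∈p) in x∉P xP

    ∉⇒∁∈ : ∀ {P} → ¬ P ∈ᵤ p → ∁ P ∈ᵤ p
    ∉⇒∁∈ {P} P∉p = [ (λ P∈p → contradiction P∈p P∉p) , id ]′ (ultra p P)

    ⋂∈ : ∀ {l} → All (_∈ᵤ p) l → ⋂ l ∈ᵤ p
    ⋂∈ []       = univ p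
    ⋂∈ (m ∷ ms) = meet p m (⋂∈ ms)

    without∈ : Free p → ∀ y → without y ∈ᵤ p
    without∈ free y =
      let X , h      = ¬∀⇒∃¬ (free y)
          X∈p , y∉X = ¬→ h
      in upward p (λ x xX → lift λ x≈y → y∉X (respects X x≈y xX)) X∈p

    -- A free ultrafilter contains the complement of every point, hence of every finite list.
    inhabited-outside : Free p → ∀ {l} → All (_∈ᵤ p) l → ∀ L →
      ∃[ x ] (∀ {P} → P ∈ₗ l → x ∈ P) × ¬ Any (x ≈_) L
    inhabited-outside free {l} l∈p L =
      let x , x∈ = inhabited _ (⋂∈ (All.++⁺ l∈p (All.map⁺ (All.universal (without∈ free) L))))
      in x , (λ m → ∈⋂⁻ x∈ (∈-++⁺ˡ m)) , All.All¬⇒¬Any (All.tabulate λ y∈L →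
           lower (∈⋂⁻ x∈ (∈-++⁺ʳ l (∈-map⁺ without y∈L))))

  -- A maximal M with gM and hM disjoint satisfies M ∪ g⁻¹hM ∪ h⁻¹gM = G.
  ⊲ᵤ-free : ∀ p {g h} → g ⊲ᵤ p ≈ᵤ h ⊲ᵤ p → g ≈ h
  ⊲ᵤ-free p {g} {h} gp≈hp = by-contradiction λ g≉h →
    let M , _ , con , max = Tuk.maximal λ _ w → λ (a , b , a∈ , _) → w a∈ in
    refute g≉h M con max
    where
    Bad : List Carrier → Set (c ⊔ ℓ)
    Bad l = ∃[ a ] ∃[ b ] a ∈ₗ l × b ∈ₗ l × g ∙ a ≈ h ∙ b
    module Tuk = Tukey em fe Bad
      (λ sub (a , b , a∈ , b∈ , e) → a , b , sub a∈ , sub b∈ , e) (λ _ → false)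
    refute : ¬ g ≈ h → ∀ M → Tuk.Consistent M →
      (∀ x → ¬ T (M x) → ∃[ l ] Tuk.Within l M × Bad (x ∷ l)) → ⊥
    refute g≉h M con max = case
      where
      -- The closure of `M` under `_≈_`.
      A : Subset
      A = record
        { pred     = λ x → ∃[ y ] T (M y) × x ≈ y
        ; respects = λ e (y , y∈ , x≈y) → y , y∈ , trans (sym e) x≈y
        }
      to-M : ∀ {x} → T (M x) → x ∈ A
      to-M x∈ = _ , x∈ , refl
      gA hA : Subset
      gA = g ⊲ A
      hA = h ⊲ A
      cover : ∀ x → ¬ x ∈ A → ¬ g ∙ x ∈ hA → ¬ h ∙ x ∈ gA → ⊥
      -- Which of `a`, `b` is `x` itself decides which of the covering sets contains `x`; if both
      -- are, then `g ≈ h`.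
      cover x x∉A gx∉ hx∉ with max x (x∉A ∘ to-M)
      ... | l , w , a , b , here ≡.refl , here ≡.refl , e = g≉h (∙-cancelʳ x g h e)
      ... | l , w , a , b , here ≡.refl , there b∈ , e = gx∉ (b , to-M (w b∈) , e)
      ... | l , w , a , b , there a∈ , here ≡.refl , e = hx∉ (a , to-M (w a∈) , sym e)
      ... | l , w , a , b , there a∈ , there b∈ , e = con l w (a , b , a∈ , b∈ , e)
      disjoint : ∀ x → x ∈ gA → ¬ x ∈ hA
      disjoint x (a , (a′ , a∈ , a≈) , x≈ga) (b , (b′ , b∈ , b≈) , x≈hb) =
        con (a′ ∷ b′ ∷ []) (λ { (here ≡.refl) → a∈ ; (there (here ≡.refl)) → b∈ })
          (a′ , b′ , here ≡.refl , there (here ≡.refl) ,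
           trans (∙-congˡ (sym a≈)) (trans (sym x≈ga) (trans x≈hb (∙-congˡ b≈))))
      gA∈ : A ∈ᵤ p → gA ∈ᵤ g ⊲ᵤ p
      gA∈ A∈p = A , A∈p , λ _ → mk⇔ id id
      hA∈ : A ∈ᵤ p → hA ∈ᵤ h ⊲ᵤ p
      hA∈ A∈p = A , A∈p , λ _ → mk⇔ id id
      ⊲-cancel : ∀ k {x} → k ∙ x ∈ k ⊲ A → x ∈ A
      ⊲-cancel k {x} (a , aA , e) = respects A (sym (∙-cancelˡ k x a e)) aA
      A∉p : ¬ A ∈ᵤ p
      A∉p A∈p =
        let x , xg , xh = inhabited (h ⊲ᵤ p) (gA ∩ hA)
              (meet (h ⊲ᵤ p) {gA} {hA} (Equivalence.to (gp≈hp gA) (gA∈ A∈p)) (hA∈ A∈p))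
        in disjoint x xg xh
      -- Otherwise `hA` belongs to `gp`, hence to `hp`, and `A` to `p`.
      gx∉p : ¬ pre g hA ∈ᵤ p
      gx∉p m = A∉p (upward p (λ x → ⊲-cancel h)
        (∈⊲ᵤ⁻ p h hA (Equivalence.to (gp≈hp hA) (∈⊲ᵤ⁺ p g hA m))))
      hx∉p : ¬ pre h gA ∈ᵤ p
      hx∉p m = A∉p (upward p (λ x → ⊲-cancel g)
        (∈⊲ᵤ⁻ p g gA (Equivalence.from (gp≈hp gA) (∈⊲ᵤ⁺ p h gA m))))
      case : ⊥
      case =
        let x , x∉A , gx∉ , hx∉ = inhabited p (∁ A ∩ (∁ (pre g hA) ∩ ∁ (pre h gA)))
              (meet p (∉⇒∁∈ p A∉p) (meet p (∉⇒∁∈ p gx∉p) (∉⇒∁∈ p hx∉p)))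
        in cover x x∉A gx∉ hx∉

  -- Extension of families to free ultrafilters.

  module _ (X : Subset) (base : Subset → Bool) where

    -- The intersection of `X` with the sets of `l`. A family is consistent when all these are
    -- infinite, which is what makes the resulting ultrafilter free.
    Trace : List Subset → Pred Carrier (lsuc s)
    Trace l x = x ∈ X × (∀ {P} → P ∈ₗ l → x ∈ P)

    private
      module Tuk = Tukey em fe (Listed ∘ Trace)
        (λ sub (L , in-L) → L , λ x (xX , x∈) → in-L x (xX , x∈ ∘ sub)) base

    maximal⇒ultrafilter : ∀ M → Tuk.Consistent M →
      (∀ P → ¬ T (M P) → ∃[ l ] Tuk.Within l M × Listed (Trace (P ∷ l))) →
      ∃[ p ] p ∈* X × (∀ P → T (M P) → P ∈ᵤ p)
    maximal⇒ultrafilter M con max = p , (free , X∈p) , λ P → lift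
      where
      -- If `P` were outside `M`, some `l′` in `M` would meet `P` finitely within `X`; then
      -- `l ++ l′` would have finite trace.
      infer : ∀ P l L → Tuk.Within l M → (∀ x → Trace l x → ¬ Any (x ≈_) L → x ∈ P) → T (M P)
      infer P l L w h = by-contradiction λ P∉ →
        let l′ , w′ , L′ , in-L′ = max P P∉
        in con (l ++ l′) (λ m → [ w , w′ ]′ (∈-++⁻ l m)) (L ++ L′ , λ x (xX , x∈) →
          by-contradiction λ x∉ → x∉ (Any.++⁺ʳ L (in-L′ x (xX , λ
            { (here ≡.refl) → h x (xX , λ m → x∈ (∈-++⁺ˡ m)) (x∉ ∘ Any.++⁺ˡ)
            ; (there m)     → x∈ (∈-++⁺ʳ l m) }))))

      ultra′ : ∀ P → Dec (T (M P)) → T (M P) ⊎ T (M (∁ P))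
      ultra′ P (yes P∈) = inj₁ P∈
      ultra′ P (no P∉)  = let l , w , L , in-L = max P P∉ in
        inj₂ (infer (∁ P) l L w λ x (xX , x∈) x∉L xP →
          x∉L (in-L x (xX , λ { (here ≡.refl) → xP ; (there m) → x∈ m })))

      p : Ultrafilter
      p = record
        { member = λ P → Lift _ (T (M P))
        ; proper = λ { (lift m) → con (∅ ∷ []) (λ { (here ≡.refl) → m })
            ([] , λ x (_ , x∈) → ⊥-elim (lower (x∈ (here ≡.refl)))) }
        ; univ   = lift (infer full [] [] (λ ()) λ _ _ _ → _)
        ; meet   = λ { {P} {Q} (lift m) (lift n) → lift (infer (P ∩ Q) (P ∷ Q ∷ []) []
            (λ { (here ≡.refl) → m ; (there (here ≡.refl)) → n })
            λ x (_ , x∈) _ → x∈ (here ≡.refl) , x∈ (there (here ≡.refl))) }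
        ; upward = λ { {P} {Q} P⊆Q (lift m) → lift (infer Q (P ∷ []) []
            (λ { (here ≡.refl) → m }) λ x (_ , x∈) _ → P⊆Q x (x∈ (here ≡.refl))) }
        ; ultra  = λ P → [ inj₁ ∘ lift , inj₂ ∘ lift ]′ (ultra′ P (em _))
        }

      X∈p : X ∈ᵤ p
      X∈p = lift (infer X [] [] (λ ()) λ _ (xX , _) _ → xX)

      free : Free p
      free y y∈ = lower (y∈ (without y)
        (lift (infer (without y) [] (y ∷ []) (λ ()) λ _ _ x∉ → lift (x∉ ∘ here)))) refl

    abstract
      ultrafilter-extending : (∀ l → Tuk.Within l base → ¬ Listed (Trace l)) →
        ∃[ p ] p ∈* X × (∀ P → T (base P) → P ∈ᵤ p)
      ultrafilter-extending base-con =
        let M , base⊆M , con , max = Tuk.maximal base-con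
            p , p∈*X , M⊆p         = maximal⇒ultrafilter M con max
        in p , p∈*X , λ P → M⊆p P ∘ base⊆M P

-- Shifted products in sets that witness non-scatteredness: part (iii).

head-or : List ℕ → ℕ → ℕ
head-or []      j = j
head-or (i ∷ _) _ = i

linked-uncons : ∀ {i is j} → Linked _<_ (i ∷ is ∷ʳ j) → i < head-or is j × Linked _<_ (is ∷ʳ j)
linked-uncons {is = []}    (i<j ∷ lk) = i<j , lk
linked-uncons {is = _ ∷ _} (i<k ∷ lk) = i<k , lk

linked-cons : ∀ {i is j} → i < head-or is j → Linked _<_ (is ∷ʳ j) → Linked _<_ (i ∷ is ∷ʳ j)
linked-cons {is = []}    i<j lk = i<j ∷ lk
linked-cons {is = _ ∷ _} i<k lk = i<k ∷ lk

module Scattering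
  (em : ∀ a → ExcludedMiddle a) (fe : ∀ a b → Extensionality a b) {c ℓ} (G : Group c ℓ)
  where
  open Group G
  open GroupProperties G
  open SubsetsOf G
  open Subset
  open Ultrafilter
  open Listings setoid
  open Classical em
  open Ultrafilters em fe G

  shifted-prod-∷ : ∀ g i is j y →
    prod g (i ∷ is ∷ʳ j) ∙ y ≈ g i ∙ (prod g (is ∷ʳ j) ∙ y)
  shifted-prod-∷ g i is j y = assoc _ _ _

  module _
    (X : Subset) (X-inf : Infinite (_∈ X))
    (Δ-inf : ∀ p → p ∈* X → ¬ Cardinality.Finite ultrafilterSetoid (Δ p X))
    where

    -- It belongs to an ultrafilter `q` exactly when `X ∈ gq` implies `P ∈ gq`, which is the
    -- absorption condition on closed sets.
    relative : Carrier → Subset → Subset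
    relative g P = record
      { pred     = λ x → g ∙ x ∈ X → g ∙ x ∈ P
      ; respects = λ e h gx∈ → respects P (∙-congˡ e) (h (respects X (∙-congˡ (sym e)) gx∈))
      }

    Confined : List Carrier → List Subset → Pred Carrier (lsuc s)
    Confined gs l x = x ∈ X × (∀ {g P} → g ∈ₗ gs → P ∈ₗ l → x ∈ relative g P)

    private
      module Tuk = Tukey em fe (λ l → ∃[ gs ] Listed (Confined gs l))
        (λ sub (gs , L , in-L) → gs , L , λ x (xX , h) → in-L x (xX , λ g P → h g (sub P)))
        (λ _ → false)

    -- A maximal family M with the sets Confined gs l (l ⊆ M) infinite is the filter of a minimal
    -- closed subset of X* among those absorbing each point gp with X ∈ gp.
    found : ∃[ M ] (∀ P → T false → T (M P)) × Tuk.Consistent M ×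
      (∀ P → ¬ T (M P) → ∃[ l ] Tuk.Within l M × ∃[ gs ] Listed (Confined gs (P ∷ l)))
    found = Tuk.maximal λ
      { []      _ (gs , L , in-L) → X-inf (Listed⇒Finite em (respects X) (L , λ x xX → in-L x (xX , λ _ ())))
      ; (P ∷ l) w _               → w (here ≡.refl) }

    M : Subset → Bool
    M = proj₁ found

    M-consistent : Tuk.Consistent M
    M-consistent = proj₁ (proj₂ (proj₂ found))

    M-maximal : ∀ P → ¬ T (M P) → ∃[ l ] Tuk.Within l M × ∃[ gs ] Listed (Confined gs (P ∷ l))
    M-maximal = proj₂ (proj₂ (proj₂ found))

    -- Confinement to `P` under all `g ∙ k` with `k` in `gs` already forces confinement to
    -- `relative g P` under `gs`, so adding that set keeps `M` consistent.
    M-relative : ∀ g P → T (M P) → T (M (relative g P))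
    M-relative g P P∈ = by-contradiction λ N∉ →
      let l , w , gs , L , in-L = M-maximal (relative g P) N∉
      in M-consistent (P ∷ l) (λ { (here ≡.refl) → P∈ ; (there m) → w m })
        (gs ++ map (g ∙_) gs , L , λ x (xX , h) → in-L x (xX , λ
          { {k} k∈ (here ≡.refl) kx∈ gkx∈ → respects P (assoc g k x)
              (h (∈-++⁺ʳ gs (∈-map⁺ (g ∙_) k∈)) (here ≡.refl)
                (respects X (sym (assoc g k x)) gkx∈))
          ; k∈ (there m) → h (∈-++⁺ˡ k∈) (there m) }))

    p-found : ∃[ p ] p ∈* X × (∀ P → T (M P) → P ∈ᵤ p)
    p-found = ultrafilter-extending X M λ l w (L , in-L) →
      -- For the single translate `ε`, the confined set is the trace.
      M-consistent l w (ε ∷ [] , L , λ x (xX , h) → in-L x (xX , λ {P} m →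
        respects P (identityˡ x) (h (here ≡.refl) m (respects X (sym (identityˡ x)) xX))))

    p : Ultrafilter
    p = proj₁ p-found

    p∈*X : p ∈* X
    p∈*X = proj₁ (proj₂ p-found)

    M⊆p : ∀ P → T (M P) → P ∈ᵤ p
    M⊆p = proj₂ (proj₂ p-found)

    -- Every point gp with X ∈ gp lies in the minimal closed set, so one of
    -- finitely many translates of it contains P.
    returns-cover : ∀ P → P ∈ᵤ p →
      ∃[ gs ] ∀ g → pre g X ∈ᵤ p → ∃[ h ] h ∈ₗ gs × pre (h ∙ g) P ∈ᵤ p
    returns-cover P P∈p with M-maximal (∁ P) (λ m → ∁∉ p P∈p (M⊆p (∁ P) m))
    ... | l , w , gs , L , in-L = gs , λ g gX∈p → by-contradiction λ none →
      -- If no translate worked, `p`-almost every `x` would have `g ∙ x` in the finite set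
      -- `Confined gs (∁ P ∷ l)`, yet `x` can be chosen off the translated list.
      let x , x∈ , x∉L = inhabited-outside p (proj₁ p∈*X) (conditions∈p g gX∈p none) (map (g ⁻¹ ∙_) L)
          gx∈X : g ∙ x ∈ X
          gx∈X = x∈ (here ≡.refl)
      in x∉L (Any.map⁺ (Any.map
           (λ {y} e → trans (sym (\\-leftDividesʳ g x)) (∙-congˡ e))
           (in-L (g ∙ x) (gx∈X , λ
             { {h} h∈ (here ≡.refl) _ hgx∈P →
                 x∈ (there (∈-++⁺ˡ (∈-map⁺ (λ h → ∁ (pre (h ∙ g) P)) h∈)))
                    (respects P (sym (assoc h g x)) hgx∈P)
             ; h∈ (there Q∈) → x∈ (there (∈-++⁺ʳ _
                 (∈-cartesianProductWith⁺ (λ h Q → relative g (relative h Q)) h∈ Q∈))) gx∈X }))))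
      where
      conditions : Carrier → List Subset
      conditions g = pre g X ∷ map (λ h → ∁ (pre (h ∙ g) P)) gs
        ++ cartesianProductWith (λ h Q → relative g (relative h Q)) gs l
      conditions∈p : ∀ g → pre g X ∈ᵤ p → ¬ (∃[ h ] h ∈ₗ gs × pre (h ∙ g) P ∈ᵤ p) →
        All (_∈ᵤ p) (conditions g)
      conditions∈p g gX∈p none = gX∈p ∷ All.++⁺
        (All.map⁺ (All.tabulate λ {h} h∈ → ∉⇒∁∈ p λ m → none (h , h∈ , m)))
        (All.tabulate λ m → relatives∈p (∈-cartesianProductWith⁻ (λ h Q → relative g (relative h Q)) gs l m))
        where
        relatives∈p : ∀ {R} →
          (∃[ h ] ∃[ Q ] h ∈ₗ gs × Q ∈ₗ l × R ≡ relative g (relative h Q)) → R ∈ᵤ p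
        relatives∈p (h , Q , _ , Q∈ , ≡.refl) =
          M⊆p _ (M-relative g (relative h Q) (M-relative h Q (w Q∈)))

    Δ-respects : ∀ q Y → Δ q Y Respects _≈ᵤ_
    Δ-respects q Y r≈r′ (g , gY∈ , r≈gq) = g , gY∈ , λ Z → let open Equivalence in
      mk⇔ (to (r≈gq Z) ∘ from (r≈r′ Z)) (to (r≈r′ Z) ∘ from (r≈gq Z))

    -- From `h ∙ g ≈ k` with `h` in `gs` and `k` in `K` follows `g ≈ h⁻¹k`, leaving finitely many
    -- points `gp`.
    Δ-listed : ∀ P gs → (∀ g → pre g X ∈ᵤ p → ∃[ h ] h ∈ₗ gs × pre (h ∙ g) P ∈ᵤ p) →
      Listed (λ g → pre g P ∈ᵤ p) → Listings.Listed ultrafilterSetoid (Δ p X)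
    Δ-listed P gs cover (K , in-K) =
      cartesianProductWith point gs K , λ q (g , gX∈ , q≈gp) → listed q g q≈gp (cover g (∈⊲ᵤ⁻ p g X gX∈))
      where
      point : Carrier → Carrier → Ultrafilter
      point h k = (h ⁻¹ ∙ k) ⊲ᵤ p
      point≈ : ∀ {q g h k} → q ≈ᵤ g ⊲ᵤ p → h ∙ g ≈ k → q ≈ᵤ point h k
      point≈ {q} {g} {h} q≈gp e Y =
        let open Equivalence
            gp≈ = ⊲ᵤ-congˡ {p} (trans (sym (\\-leftDividesʳ h g)) (∙-congˡ e)) Y
        in mk⇔ (to gp≈ ∘ to (q≈gp Y)) (from (q≈gp Y) ∘ from gp≈)
      listed : ∀ q g → q ≈ᵤ g ⊲ᵤ p → (∃[ h ] h ∈ₗ gs × pre (h ∙ g) P ∈ᵤ p) →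
        Any (q ≈ᵤ_) (cartesianProductWith point gs K)
      listed q g q≈gp (h , h∈ , hgP∈p) = Any.cartesianProductWith⁺ point
        (λ { ≡.refl e → point≈ {q} {g} {h} q≈gp e }) h∈ (in-K (h ∙ g) hgP∈p)

    returns-infinite : ∀ P → P ∈ᵤ p → Infinite (λ g → pre g P ∈ᵤ p)
    returns-infinite P P∈p fin =
      let gs , cover = returns-cover P P∈p
      in Δ-inf p p∈*X (Listings.Listed⇒Finite ultrafilterSetoid em (λ {q} {q′} → Δ-respects p X {q} {q′})
           (Δ-listed P gs cover (Finite⇒Listed fin)))

    -- `W (prefix g n)` is the set `Xₙ` of the construction.
    W : List Carrier → Subset
    W []      = X
    W (g ∷ l) = W l ∩ pre g (W l)

    W∈p : ∀ l → Along (λ l g → pre g (W l) ∈ᵤ p) l → W l ∈ᵤ p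
    W∈p []      _        = proj₂ p∈*X
    W∈p (g ∷ l) (q , qs) = meet p (W∈p l qs) q

    W-antitone : ∀ g {m n} → m ≤ n → W (prefix g n) ⊆ W (prefix g m)
    W-antitone g {m} {n} m≤n x x∈ with m≤n⇒m<n∨m≡n m≤n
    ... | inj₂ ≡.refl = x∈
    W-antitone g {m} {suc n} _ x x∈ | inj₁ m<1+n = W-antitone g (s≤s⁻¹ m<1+n) x (proj₁ x∈)

    -- After the first factor `g i` is removed, the rest lies in `W` at a later index, which `g i`
    -- maps into `W (prefix g i)`.
    shiftedFP-W : ∀ (g b : ℕ → Carrier) → (∀ n → b n ∈ W (prefix g (suc n))) → ∀ is j → Linked _<_ (is ∷ʳ j) →
      prod g (is ∷ʳ j) ∙ b j ∈ W (prefix g (head-or is j))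
    shiftedFP-W g b b∈ [] j _ =
      respects (W (prefix g j)) (∙-congʳ (sym (identityʳ (g j)))) (proj₂ (b∈ j))
    shiftedFP-W g b b∈ (i ∷ is) j lk =
      let i<k , lk′ = linked-uncons lk
      in respects (W (prefix g i)) (sym (shifted-prod-∷ g i is j (b j)))
           (proj₂ (W-antitone g i<k _ (shiftedFP-W g b b∈ is j lk′)))

    shiftedFP⊆X : ∀ (g b : ℕ → Carrier) → (∀ n → b n ∈ W (prefix g (suc n))) → PiecewiseShiftedFP g b ⊆ X
    shiftedFP⊆X g b b∈ x (is , j , lk , lift x≈) =
      respects X (sym x≈) (W-antitone g {n = head-or is j} z≤n _ (shiftedFP-W g b b∈ is j lk))

    returning-sequence : ∃[ g ] InjectiveSeq g × (∀ n → pre (g n) (W (prefix g n)) ∈ᵤ p)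
    returning-sequence = injective-choice em (λ l g → pre g (W l) ∈ᵤ p)
      (λ l → pre-congˡ {p} (W l)) (λ l al → returns-infinite (W l) (W∈p l al))

    contains-shiftedFP : ∃[ Y ] IsPiecewiseShiftedFPSet Y × Y ⊆ X
    contains-shiftedFP = build returning-sequence
      where
      build : (∃[ g ] InjectiveSeq g × (∀ n → pre (g n) (W (prefix g n)) ∈ᵤ p)) →
        ∃[ Y ] IsPiecewiseShiftedFPSet Y × Y ⊆ X
      build (g , g-inj , h) =
        PiecewiseShiftedFP g b , (g , b , g-inj , λ _ → mk⇔ id id) , shiftedFP⊆X g b (proj₂ ∘ entry)
        where
        entry : ∀ n → ∃[ x ] x ∈ W (prefix g (suc n))
        entry n = inhabited p (W (prefix g (suc n)))
          (W∈p (prefix g (suc n)) (along-prefix (λ l g → pre g (W l) ∈ᵤ p) h (suc n)))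
        b : ℕ → Carrier
        b = proj₁ ∘ entry

  -- Piecewise shifted FP-sets are not scattered.

  module _ (g b : ℕ → Carrier) (g-inj : InjectiveSeq g) where

    shiftedFP-infinite : Infinite (_∈ PiecewiseShiftedFP g b)
    shiftedFP-infinite fin =
      let l , in-l = Finite⇒Listed fin
          -- As `b` may repeat values, the last index is fixed at `N`, beyond all first indices
          -- tried, and only the first factor varies.
          N = suc (length l)
          i , j , i<j , e = list-pigeonhole l (λ i → prod g (i ∷ N ∷ []) ∙ b N) λ i i≤ →
            in-l _ (i ∷ [] , N , s≤s i≤ ∷ [-] , lift refl)
      in <⇒≢ i<j (g-inj (∙-cancelʳ _ _ _ (∙-cancelʳ (b N) _ _ e)))

    -- Indices increase, so bounding the first one bounds them all.
    Tail : ℕ → Subset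
    Tail m = record
      { pred     = λ x → Σ (List ℕ) λ is → ∃[ j ] Linked _<_ (is ∷ʳ j) × m ≤ head-or is j ×
                     Lift c (x ≈ prod g (is ∷ʳ j) ∙ b j)
      ; respects = λ { e (is , j , lk , m≤ , lift x≈) → is , j , lk , m≤ , lift (trans (sym e) x≈) }
      }

    Tail-split : ∀ m x → x ∈ Tail m →
      x ∈ Tail (suc m) ⊎ g m ⁻¹ ∙ x ∈ Tail (suc m) ⊎ x ≈ g m ∙ b m
    Tail-split m x (is , j , lk , m≤ , lift x≈) with m≤n⇒m<n∨m≡n m≤
    ... | inj₁ m< = inj₁ (is , j , lk , m< , lift x≈)
    Tail-split m x ([] , j , lk , m≤ , lift x≈)     | inj₂ ≡.refl =
      inj₂ (inj₂ (trans x≈ (∙-congʳ (identityʳ (g j)))))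
    Tail-split m x (i ∷ is , j , lk , m≤ , lift x≈) | inj₂ ≡.refl =
      let i<k , lk′ = linked-uncons lk
      in inj₂ (inj₁ (is , j , lk′ , i<k , lift
           (trans (∙-congˡ (trans x≈ (shifted-prod-∷ g i is j (b j)))) (\\-leftDividesʳ (g i) _))))

    Tail-∙ : ∀ {i m x} → i < m → x ∈ Tail m → g i ∙ x ∈ PiecewiseShiftedFP g b
    Tail-∙ {i} i<m (is , j , lk , m≤ , lift x≈) =
      i ∷ is , j , linked-cons (≤-trans i<m m≤) lk ,
      lift (trans (∙-congˡ x≈) (sym (shifted-prod-∷ g i is j (b j))))

    -- By `Tail-split`, up to one point, which a free `p` ignores, `Tail m` is covered by
    -- `Tail (suc m)` and its translate by `g m`; so `v` or `g m ⁻¹ ∙ v` serves next.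
    Tail-translate : ∀ p → p ∈* PiecewiseShiftedFP g b → ∀ m → ∃[ v ] pre v (Tail m) ∈ᵤ p
    Tail-translate p (_ , Y∈p) zero = ε , upward p
      (λ { x (is , j , lk , lift x≈) → is , j , lk , z≤n , lift (trans (identityˡ x) x≈) }) Y∈p
    Tail-translate p p∈*Y@(free , _) (suc m) with Tail-translate p p∈*Y m
    ... | v , v∈ with em _ {pre v (Tail (suc m)) ∈ᵤ p} | em _ {pre (g m ⁻¹ ∙ v) (Tail (suc m)) ∈ᵤ p}
    ... | yes v∈′ | _       = v , v∈′
    ... | no _    | yes v∈′ = g m ⁻¹ ∙ v , v∈′
    ... | no v∉   | no v′∉  =
      let x , vx∈ , vx∉ , v′x∉ , lift x≉ = inhabited p
            (pre v (Tail m) ∩ (∁ (pre v (Tail (suc m))) ∩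
              (∁ (pre (g m ⁻¹ ∙ v) (Tail (suc m))) ∩ without (v ⁻¹ ∙ (g m ∙ b m)))))
            (meet p v∈ (meet p (∉⇒∁∈ p v∉) (meet p (∉⇒∁∈ p v′∉) (without∈ p free _))))
      in ⊥-elim ([ vx∉ , [ (λ m′ → v′x∉ (respects (Tail (suc m)) (sym (assoc _ _ _)) m′))
                         , (λ e → x≉ (trans (sym (\\-leftDividesʳ v x)) (∙-congˡ e))) ]′ ]′
           (Tail-split m (v ∙ x) vx∈))

    shiftedFP-Δ-infinite : ∀ p → p ∈* PiecewiseShiftedFP g b →
      ¬ Cardinality.Finite ultrafilterSetoid (Δ p (PiecewiseShiftedFP g b))
    shiftedFP-Δ-infinite p p∈*Y fin =
      let l , in-l = Listings.Finite⇒Listed ultrafilterSetoid fin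
          -- This bound allows every `i ≤ length l`, giving one more point `(g i ∙ v) ⊲ᵤ p` than the
          -- list has places.
          v , v∈   = Tail-translate p p∈*Y (suc (length l))
          i , j , i<j , e = Listings.list-pigeonhole ultrafilterSetoid l (λ i → (g i ∙ v) ⊲ᵤ p) λ i i≤ →
            in-l ((g i ∙ v) ⊲ᵤ p) (g i ∙ v
              , ∈⊲ᵤ⁺ p (g i ∙ v) (PiecewiseShiftedFP g b) (upward p
                  (λ x vx∈ → respects (PiecewiseShiftedFP g b) (sym (assoc _ _ _)) (Tail-∙ (s≤s i≤) vx∈)) v∈)
              , λ Y → mk⇔ id id)
      in <⇒≢ i<j (g-inj (∙-cancelʳ v _ _ (⊲ᵤ-free p e)))

  module _ (A : Subset) where

    ¬Scattered⇒ : ¬ Scattered A → ∃[ Y ] IsPiecewiseShiftedFPSet Y × Y ⊆ A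
    ¬Scattered⇒ ¬scattered =
      let X , h         = ¬∀⇒∃¬ ¬scattered
          X-inf , h′    = ¬→ h
          X⊆A , none    = ¬→ h′
          Y , Y-fp , Y⊆X = contains-shiftedFP X X-inf λ p p∈*X fin → none (p , p∈*X , fin)
      in Y , Y-fp , λ x → X⊆A x ∘ Y⊆X x

    ⇒¬Scattered : (∃[ Y ] IsPiecewiseShiftedFPSet Y × Y ⊆ A) → ¬ Scattered A
    ⇒¬Scattered (Y , (g , b , g-inj , Y≐) , Y⊆A) scattered =
      let p , p∈* , fin = scattered (PiecewiseShiftedFP g b) (shiftedFP-infinite g b g-inj)
            λ x x∈ → Y⊆A x (Equivalence.from (Y≐ x) x∈)
      in shiftedFP-Δ-infinite g b g-inj p p∈* fin

theorem4p3 :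
    (∀ a → ExcludedMiddle a) →
    (∀ a b → Extensionality a b) →
    ∀ {c ℓ} (G : Group c ℓ) →
    let open Group G using (_∙_)
        open SubsetsOf G in
    InfiniteGroup →
    (A : Subset) →
    ((n : ℕ) →
      (¬ Thin n A) ⇔
      (∃[ F ] (_∈ F) HasSize (suc n) × ∃[ x ] InjectiveSeq x × (∀ k → F ⊳ x k ⊆ A)))
    ×
    ((¬ Sparse A) ⇔
      (∃[ x ] ∃[ y ] InjectiveSeq x × InjectiveSeq y ×
        (∀ n m → n ≤ m → (x n ∙ y m) ∈ A)))
    ×
    ((¬ Scattered A) ⇔
      (∃[ Y ] IsPiecewiseShiftedFPSet Y × Y ⊆ A))
    ×
    -- Nonemptiness is required because ∅ is trivially recurrent.
    ((∃[ B ] B ⊆ A × (∃[ b ] b ∈ B) × Recurrent B) ⇔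
      (∃[ x ] x ∈ A × ∃[ Y ] IsFPSet Y × (x ⊲ Y) ⊆ A))
theorem4p3 em fe G _ A =
    (λ n → mk⇔ (¬Thin⇒ A) (⇒¬Thin A))
  , mk⇔ (¬Sparse⇒ A) (⇒¬Sparse A)
  , mk⇔ (¬Scattered⇒ A) (⇒¬Scattered A)
  , mk⇔ (recurrent⇒FP A) (FP⇒recurrent A)
  where
  open ThinSparse em G
  open Scattering em fe G
  open Recurrence em G
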